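{- Let $q$ be an odd prime power, let $f(X)=X^2+bX+c$ be a quadratic polynomial over $\mathbb F_q$ with $c\neq 0$, and let $\theta_1$ and $\theta_2$ be the two roots of $f(X)$ (in an algebraic closure of $\mathbb F_q$). Then for any positive integer $n$ that is coprime to $q$, $\Lambda_n(b,c)=0$ if and only if $\operatorname{ord}\left(\frac{\theta_1}{\theta_2}\right)=n$.
   Context: $\operatorname{ord}$ denotes multiplicative order. Lucas atoms: let $B,C$ be algebraically independent indeterminates over $\mathbb F_q$, and let $\alpha,\beta$ be the two roots of $T^2+BT+C$ in an algebraic closure of $\mathbb F_q(B,C)$. Let $\Phi_n(X)$ be the $n$-th cyclotomic polynomial over $\mathbb F_q$, $\varphi$ Euler's totient function, and $\Phi_n^{\mathrm{hom}}(\alpha,\beta)=\beta^{\varphi(n)}\Phi_n(\alpha/\beta)$. The $n$-th Lucas atom $\Lambda_n(B,C)\in\mathbb F_q[B,C]$ is defined by $\Lambda_1(B,C)=1$ for $n=1$, and for $n\ge 2$ as the unique polynomial with $\Lambda_n(B,C)=\Phi_n^{\mathrm{hom}}(\alpha,\beta)$.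
   Formalization: The case n = 1 with θ₁ = θ₂ is excluded, since there Λ₁(b,c) = 1 ≠ 0 although ord(θ₁/θ₂) = 1; all fields, including the algebraic closures, are taken with decidable equality (automatic classically). -}

module Defs where

open import Algebra.Bundles using (CommutativeRing)
open import Algebra.Bundles.Raw using (RawRing)
import Algebra.Definitions.RawSemiring as RawSemiringDefinitions
open import Algebra.Morphism.Structures using (IsRingHomomorphism)
open import Data.Bool.Base using (if_then_else_)
open import Data.Fin.Base using (Fin)
open import Data.List.Base using (List; []; _∷_; map; foldr; filter; length; applyUpTo)
open import Data.List.Relation.Unary.All using (all?)
open import Data.Nat.Base as ℕ using (ℕ; zero; suc; pred)
open import Data.Nat.Coprimality using (coprime?)
open import Data.Nat.Divisibility using (_∣_; _∣?_)
open import Data.Nat.Primality using (Prime)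
open import Data.Product.Base using (_×_; _,_; proj₁; ∃; ∃₂)
open import Function.Base using (_∘_; id)
open import Function.Bundles using (Inverse)
open import Level using (Level; _⊔_) renaming (suc to lsuc)
open import Relation.Binary.Definitions using (Decidable)
open import Relation.Binary.PropositionalEquality using (_≡_; setoid)
open import Relation.Nullary.Decidable.Core using (does)
open import Relation.Nullary.Negation.Core using (¬_)

private
  variable
    c ℓ c₁ ℓ₁ c₂ ℓ₂ : Level

------------------------------------------------------------------------
-- Arithmetic

IsOddPrimePower : ℕ → Set
IsOddPrimePower q =
  (∃₂ λ p k → Prime p × 1 ℕ.≤ k × q ≡ p ℕ.^ k) × ¬ (2 ∣ q)

totient : ℕ → ℕ
totient n = length (filter (λ k → coprime? k n) (applyUpTo suc n))

properDivisors : ℕ → List ℕ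
properDivisors n = filter (_∣? n) (applyUpTo suc (pred n))

------------------------------------------------------------------------
-- Fields

-- Fields in the usual sense of discrete constructive algebra: equality is
-- decidable. The inverse is a total operation whose value at 0# is
-- unconstrained.

record Field c ℓ : Set (lsuc (c ⊔ ℓ)) where
  infix 9 _⁻¹
  infix 4 _≟_
  field
    commutativeRing : CommutativeRing c ℓ
  open CommutativeRing commutativeRing public
  field
    _≟_      : Decidable _≈_
    1≉0      : ¬ (1# ≈ 0#)
    _⁻¹      : Carrier → Carrier
    inverseʳ : ∀ x → ¬ (x ≈ 0#) → x * x ⁻¹ ≈ 1#

  open RawSemiringDefinitions (RawRing.rawSemiring rawRing) public using (_^_)

∣_∣≡_ : Field c ℓ → ℕ → Set (c ⊔ ℓ)
∣ F ∣≡ q = Inverse (Field.setoid F) (setoid (Fin q))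

IsHom : (F : Field c₁ ℓ₁) (K : Field c₂ ℓ₂) →
        (Field.Carrier F → Field.Carrier K) → Set (c₁ ⊔ ℓ₁ ⊔ ℓ₂)
IsHom F K = IsRingHomomorphism (Field.rawRing F) (Field.rawRing K)

HasOrder : (K : Field c ℓ) → Field.Carrier K → ℕ → Set ℓ
HasOrder K x n =
  1 ℕ.≤ n × x ^ n ≈ 1# × (∀ m → 1 ℕ.≤ m → m ℕ.< n → ¬ (x ^ m ≈ 1#))
  where open Field K

------------------------------------------------------------------------
-- Polynomials

-- A polynomial is its list of coefficients, constant term first. Trailing
-- zeros are allowed, so equality compares coefficients.

module _ (R : RawRing c ℓ) where
  open RawRing R

  coeff : List Carrier → ℕ → Carrier
  coeff []      _       = 0#
  coeff (a ∷ p) zero    = a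
  coeff (a ∷ p) (suc i) = coeff p i

  record EqPoly (p q : List Carrier) : Set ℓ where
    constructor mkEq
    field
      coeff-≈ : ∀ i → coeff p i ≈ coeff q i

  addPoly : List Carrier → List Carrier → List Carrier
  addPoly []      q       = q
  addPoly (a ∷ p) []      = a ∷ p
  addPoly (a ∷ p) (b ∷ q) = (a + b) ∷ addPoly p q

  scalePoly : Carrier → List Carrier → List Carrier
  scalePoly a = map (a *_)

  mulPoly : List Carrier → List Carrier → List Carrier
  mulPoly []      q = []
  mulPoly (a ∷ p) q = addPoly (scalePoly a q) (0# ∷ mulPoly p q)

  infix 10 _[X]
  _[X] : RawRing c ℓ
  _[X] = record
    { Carrier = List Carrier
    ; _≈_     = EqPoly
    ; _+_     = addPoly
    ; _*_     = mulPoly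
    ; -_      = map -_
    ; 0#      = []
    ; 1#      = 1# ∷ []
    }

-- The value at x of the polynomial obtained by applying f to coefficients.

eval : {A : Set c₁} (S : RawRing c₂ ℓ₂) → (A → RawRing.Carrier S) →
       RawRing.Carrier S → List A → RawRing.Carrier S
eval S f x []      = RawRing.0# S
eval S f x (a ∷ p) = f a + x * eval S f x p
  where open RawRing S

-- F[B,C] is represented as F[B][C].

F[B,C] : Field c ℓ → RawRing c ℓ
F[B,C] F = (Field.rawRing F [X]) [X]

eval₂ : {A : Set c₁} (K : Field c₂ ℓ₂) → (A → Field.Carrier K) →
        Field.Carrier K → Field.Carrier K → List (List A) → Field.Carrier K
eval₂ K f u v = eval S (eval S f u) v
  where S = Field.rawRing K

-- X² + bX + c = (X − x)(X − y) in K[X].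

RootsOf : (K : Field c ℓ) → (b c x y : Field.Carrier K) → Set ℓ
RootsOf K b c x y = (c ∷ b ∷ 1# ∷ []) ≈ₚ (- x ∷ 1# ∷ []) *ₚ (- y ∷ 1# ∷ [])
  where
  open Field K
  open RawRing (rawRing [X]) using () renaming (_≈_ to _≈ₚ_; _*_ to _*ₚ_)

------------------------------------------------------------------------
-- Cyclotomic polynomials

module Cyclotomic (F : Field c ℓ) where
  open Field F
  open RawRing (rawRing [X]) using ()
    renaming (Carrier to Poly; _+_ to _+ₚ_; _*_ to _*ₚ_; -_ to -ₚ_; 1# to 1ₚ)
  open RawSemiringDefinitions (RawRing.rawSemiring (rawRing [X])) using ()
    renaming (_^_ to _^ₚ_)

  -- The degree of the zero polynomial is taken to be 0.
  degree : Poly → ℕ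
  degree []      = 0
  degree (a ∷ p) = if does (all? (_≟ 0#) p) then 0 else suc (degree p)

  -- Quotient and remainder by a nonzero g. If p = q g + r with
  -- deg r < m = deg g, then a + X p = (s + X q) g + (a + X r − s g), where
  -- s cancels the coefficient of X^m in a + X r.
  divMod : Poly → Poly → Poly × Poly
  divMod []      g = [] , []
  divMod (a ∷ p) g with divMod p g
  ... | q , r = (s ∷ q) , ((a ∷ r) +ₚ (-ₚ scalePoly rawRing s g))
    where
    m = degree g
    s = coeff rawRing (a ∷ r) m * coeff rawRing g m ⁻¹

  X^_−1 : ℕ → Poly
  X^ n −1 = ((0# ∷ 1# ∷ []) ^ₚ n) +ₚ (-ₚ 1ₚ)

  -- Φₙ = (Xⁿ − 1) / ∏_{d ∣ n, d < n} Φ_d, given Φ_d for d < n.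
  nextΦ : ℕ → (ℕ → Poly) → Poly
  nextΦ n Φ′ = proj₁ (divMod (X^ n −1) (foldr _*ₚ_ 1ₚ (map Φ′ (properDivisors n))))

  -- Course-of-values table: Φ< n d is the d-th cyclotomic polynomial for
  -- 1 ≤ d < n; the other entries are never used.
  Φ< : ℕ → ℕ → Poly
  Φ< zero    d = []
  Φ< (suc n) d = if d ℕ.≡ᵇ n then nextΦ n (Φ< n) else Φ< n d

  Φ : ℕ → Poly
  Φ n = Φ< (suc n) n

open Cyclotomic public using (Φ)

------------------------------------------------------------------------
-- Field extensions

record AlgebraicClosure (F : Field c ℓ) c′ ℓ′ : Set (c ⊔ ℓ ⊔ lsuc (c′ ⊔ ℓ′)) where
  private module F = Field F
  field
    closure : Field c′ ℓ′
  open Field closure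
  field
    ι           : F.Carrier → Carrier
    ι-isHom     : IsHom F closure ι
    isClosed    : ∀ (p : List Carrier) →
                  (∃ λ i → ¬ (coeff rawRing p (suc i) ≈ 0#)) →
                  ∃ λ x → eval rawRing id x p ≈ 0#
    isAlgebraic : ∀ x → ∃ λ (p : List F.Carrier) →
                  ¬ (EqPoly F.rawRing p []) × eval rawRing ι x p ≈ 0#

-- A field of rational functions over F in the indeterminates B and C: it is
-- generated over F by the algebraically independent elements B and C.

record RationalFunctionField (F : Field c ℓ) c′ ℓ′ : Set (c ⊔ ℓ ⊔ lsuc (c′ ⊔ ℓ′)) where
  private module F = Field F
  field
    F⟨B,C⟩ : Field c′ ℓ′
  open Field F⟨B,C⟩
  field
    ι           : F.Carrier → Carrier
    ι-isHom     : IsHom F F⟨B,C⟩ ι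
    B C         : Carrier
    independent : ∀ (P : List (List F.Carrier)) → eval₂ F⟨B,C⟩ ι B C P ≈ 0# →
                  RawRing._≈_ (F[B,C] F) P []
    generated   : ∀ x → ∃₂ λ (P Q : List (List F.Carrier)) →
                  ¬ (eval₂ F⟨B,C⟩ ι B C Q ≈ 0#) ×
                  x * eval₂ F⟨B,C⟩ ι B C Q ≈ eval₂ F⟨B,C⟩ ι B C P

------------------------------------------------------------------------
-- Lucas atoms

record GenericRoots (F : Field c ℓ) c₁ ℓ₁ c₂ ℓ₂
       : Set (c ⊔ ℓ ⊔ lsuc (c₁ ⊔ ℓ₁ ⊔ c₂ ⊔ ℓ₂)) where
  field
    functionField : RationalFunctionField F c₁ ℓ₁
  open RationalFunctionField functionField public
    using (F⟨B,C⟩; B; C) renaming (ι to F→F⟨B,C⟩)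
  field
    algebraicClosure : AlgebraicClosure F⟨B,C⟩ c₂ ℓ₂
  open AlgebraicClosure algebraicClosure public
    using () renaming (closure to Ω; ι to F⟨B,C⟩→Ω)
  field
    α β   : Field.Carrier Ω
    roots : RootsOf Ω (F⟨B,C⟩→Ω B) (F⟨B,C⟩→Ω C) α β

  F→Ω : Field.Carrier F → Field.Carrier Ω
  F→Ω = F⟨B,C⟩→Ω ∘ F→F⟨B,C⟩

  open Field Ω

  Φʰᵒᵐ : ℕ → Carrier
  Φʰᵒᵐ n = β ^ totient n * eval rawRing F→Ω (α * β ⁻¹) (Φ F n)

  -- Λ is the n-th Lucas atom. By algebraic independence of B and C, at most
  -- one polynomial (up to equality in F[B,C]) satisfies this for n ≥ 1.
  IsLucasAtom : ℕ → List (List (Field.Carrier F)) → Set (ℓ ⊔ ℓ₂)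
  IsLucasAtom n Λ =
    (n ≡ 1 → RawRing._≈_ (F[B,C] F) Λ (RawRing.1# (F[B,C] F))) ×
    (2 ℕ.≤ n → eval₂ Ω F→Ω (F⟨B,C⟩→Ω B) (F⟨B,C⟩→Ω C) Λ ≈ Φʰᵒᵐ n)

{-# OPTIONS --safe #-}
module Submission where

open import Defs
open import Algebra.Bundles using (AbelianGroup; CommutativeRing)
open import Algebra.Bundles.Raw using (RawRing)
import Algebra.Construct.DirectProduct as DirectProduct
import Algebra.Definitions.RawSemiring as RawSemiringDefinitions
open import Algebra.Morphism.Construct.Composition using (isRingHomomorphism)
import Algebra.Morphism.Construct.Identity as Identity
open import Algebra.Morphism.Structures using (IsRingHomomorphism)
import Algebra.Properties.CommutativeMonoid.Sum as SumProperties
import Algebra.Properties.CommutativeSemiring.Exp as CommutativeExpProperties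
import Algebra.Properties.Ring as RingProperties
import Algebra.Properties.Semiring.Exp as ExpProperties
import Algebra.Properties.Semiring.Mult as MultProperties
import Algebra.Solver.Ring.NaturalCoefficients.Default as SemiringSolver
open import Data.Bool.Base using (true; false)
open import Data.Bool.Properties using (T-≡)
open import Data.Empty using (⊥; ⊥-elim)
open import Data.Fin.Base using (Fin)
open import Data.Fin.Permutation using (permutation)
open import Data.List.Base using (List; []; _∷_; map; applyUpTo; foldr; length)
open import Data.List.Membership.Propositional using (_∈_)
open import Data.List.Membership.Propositional.Properties
  using (∈-applyUpTo⁺; ∈-applyUpTo⁻; ∈-filter⁺; ∈-filter⁻)
open import Data.List.Properties using (map-cong-local)
open import Data.List.Relation.Unary.All using (All; []; _∷_; all?)
import Data.List.Relation.Unary.All as All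
open import Data.List.Relation.Unary.AllPairs using ([]; _∷_)
open import Data.List.Relation.Unary.Any using (here; there)
open import Data.List.Relation.Unary.Unique.Propositional using (Unique)
open import Data.List.Relation.Unary.Unique.Propositional.Properties using (applyUpTo⁺₁; filter⁺)
open import Data.Nat.Base as ℕ using (ℕ; zero; suc; _≤_)
open import Data.Nat.Coprimality using (Coprime; coprime-Bézout)
open import Data.Nat.DivMod using (_/_; _%_; m≡m%n+[m/n]*n; m%n<n)
open import Data.Nat.Divisibility using (_∣_; divides; _∣?_; ∣⇒≤; m%n≡0⇒n∣m)
open import Data.Nat.GCD using (module Bézout)
open import Data.Nat.Induction using (<-rec)
import Data.Nat.Properties as ℕ
open import Data.Product.Base using (_×_; _,_; proj₁; proj₂; ∃)
open import Data.Sum.Base using (_⊎_; inj₁; inj₂)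
open import Function.Base using (id; _∘_)
open import Function.Bundles using (_⇔_; mk⇔; Equivalence; Inverse)
open import Level using (Level; _⊔_)
open import Relation.Binary.Definitions using (tri<; tri≈; tri>)
open import Relation.Binary.PropositionalEquality as ≡ using (_≡_)
import Relation.Binary.Reasoning.Setoid as SetoidReasoning
open import Relation.Nullary.Decidable.Core using (yes; no)
open import Relation.Nullary.Negation.Core using (¬_; contradiction)

-- Over the algebraic closure K of F, let n ≠ 0 in K. By strong induction on n the
-- roots of Φₙ are simple and are the elements of order n: the product P of the Φ_d for
-- proper divisors d of n has simple roots, all of them n-th roots of unity, so P divides
-- Xⁿ − 1, the polynomial division defining Φₙ is exact, and Xⁿ − 1 = Φₙ P has no double
-- root. That n ≠ 0 in K follows from q = 0 in F and Bézout.
--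
-- To pass from the generic roots α, β to θ₁, θ₂, write Λₙ(B,C) and Φₙʰᵒᵐ(X,Y), up to a
-- power of Y, in F[B,C][Y] / (Y² + B Y + C), where X = −B − Y. The norm to F[B,C] of
-- their difference vanishes at α, β, hence is zero, hence vanishes at θ₁, θ₂. Thus
-- Λₙ(b,c) vanishes together with Φₙ(θ₁/θ₂) or together with Φₙ(θ₂/θ₁), and the two
-- quotients have the same order.

-- The second half is shaped by the lack of a map from the closure of F(B,C), where α and β live, to
-- the closure of F, where θ₁ and θ₂ live. Only identities in F[B,C] can be specialized;
-- independence of B and C produces them from vanishing values. An equation that involves a single
-- root is therefore replaced by its norm, which mentions B and C alone. The price is that at θ₁, θ₂
-- the norm is a product of two conjugate values and nothing tells which of them is zero; this is
-- where θ₂/θ₁ enters. The denominators in α/β are cleared beforehand, so that the equation has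
-- coefficients in F[B,C]. In the first half multiplicities are handled without derivatives: a
-- polynomial is evaluated at ξ + ε in the dual numbers K[ε]. Evaluation is multiplicative over any
-- commutative ring, so the product rule comes for free, and a factorization of values, proved once
-- for all rings, serves both for roots (in K) and for multiplicities (in K[ε]).

private
  variable
    a c ℓ c₁ ℓ₁ c₂ ℓ₂ : Level

-- Evaluation of polynomials as a ring homomorphism

module ZeroProperties (R : CommutativeRing c ℓ) where
  open CommutativeRing R

  x≈0⇒x*y≈0 : ∀ {x y} → x ≈ 0# → x * y ≈ 0#
  x≈0⇒x*y≈0 x≈0 = trans (*-congʳ x≈0) (zeroˡ _)

  y≈0⇒x*y≈0 : ∀ {x y} → y ≈ 0# → x * y ≈ 0#
  y≈0⇒x*y≈0 y≈0 = trans (*-congˡ y≈0) (zeroʳ _)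

  x≈0⇒x+y≈y : ∀ {x y} → x ≈ 0# → x + y ≈ y
  x≈0⇒x+y≈y x≈0 = trans (+-congʳ x≈0) (+-identityˡ _)

  y≈0⇒x+y≈x : ∀ {x y} → y ≈ 0# → x + y ≈ x
  y≈0⇒x+y≈x y≈0 = trans (+-congˡ y≈0) (+-identityʳ _)

-- All ring laws are taken from `S`, and `R` is only a raw ring. Hence `R` may itself be a raw
-- polynomial ring, and evaluation in two variables is this module applied twice.
module Evaluation {R : RawRing c₁ ℓ₁} (S : CommutativeRing c₂ ℓ₂)
         {f : RawRing.Carrier R → CommutativeRing.Carrier S}
         (f-isHom : IsRingHomomorphism R (CommutativeRing.rawRing S) f)
         (x : CommutativeRing.Carrier S) where
  open CommutativeRing S hiding (zero)
  open ZeroProperties S using (y≈0⇒x+y≈x)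
  open SetoidReasoning setoid
  open SemiringSolver commutativeSemiring
  open RingProperties ring using (-0#≈0#; -‿+-comm; -‿distribʳ-*)
  open RawSemiringDefinitions (RawRing.rawSemiring rawRing) using (_^_)
  open RawSemiringDefinitions (RawRing.rawSemiring (R [X])) using () renaming (_^_ to _^ₚ_)
  private
    module R = RawRing R
    module f = IsRingHomomorphism f-isHom
    ev = eval rawRing f x

  eval-zero : ∀ p → (∀ i → f (coeff R p i) ≈ 0#) → ev p ≈ 0#
  eval-zero []      h = refl
  eval-zero (a ∷ p) h = begin
    f a + x * ev p  ≈⟨ +-cong (h 0) (*-congˡ (eval-zero p (h ∘ suc))) ⟩
    0# + x * 0#     ≈⟨ +-identityˡ _ ⟩
    x * 0#          ≈⟨ zeroʳ x ⟩
    0#              ∎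

  -- Equal polynomials may be lists of different lengths; when one list ends, all remaining
  -- coefficients of the other map to zero.
  eval-cong : ∀ {p q} → EqPoly R p q → ev p ≈ ev q
  eval-cong {p} {q} (mkEq h) = go p q (f.⟦⟧-cong ∘ h)
    where
    go : ∀ p q → (∀ i → f (coeff R p i) ≈ f (coeff R q i)) → ev p ≈ ev q
    go []      q       h = sym (eval-zero q (λ i → trans (sym (h i)) f.0#-homo))
    go (a ∷ p) []      h = eval-zero (a ∷ p) (λ i → trans (h i) f.0#-homo)
    go (a ∷ p) (b ∷ q) h = +-cong (h 0) (*-congˡ (go p q (h ∘ suc)))

  eval-+ : ∀ p q → ev (addPoly R p q) ≈ ev p + ev q
  eval-+ []      q       = sym (+-identityˡ _)
  eval-+ (a ∷ p) []      = sym (+-identityʳ _)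
  eval-+ (a ∷ p) (b ∷ q) = begin
    f (a R.+ b) + x * ev (addPoly R p q)       ≈⟨ +-cong (f.+-homo a b) (*-congˡ (eval-+ p q)) ⟩
    (f a + f b) + x * (ev p + ev q)
      ≈⟨ solve 5 (λ a b x p q → (a :+ b) :+ x :* (p :+ q) := (a :+ x :* p) :+ (b :+ x :* q)) refl
           (f a) (f b) x (ev p) (ev q) ⟩
    (f a + x * ev p) + (f b + x * ev q)        ∎

  eval-scale : ∀ a p → ev (scalePoly R a p) ≈ f a * ev p
  eval-scale a []      = sym (zeroʳ _)
  eval-scale a (b ∷ p) = begin
    f (a R.* b) + x * ev (scalePoly R a p)  ≈⟨ +-cong (f.*-homo a b) (*-congˡ (eval-scale a p)) ⟩
    f a * f b + x * (f a * ev p)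
      ≈⟨ solve 4 (λ a b x p → a :* b :+ x :* (a :* p) := a :* (b :+ x :* p)) refl
           (f a) (f b) x (ev p) ⟩
    f a * (f b + x * ev p)                  ∎

  eval-* : ∀ p q → ev (mulPoly R p q) ≈ ev p * ev q
  eval-* []      q = sym (zeroˡ _)
  eval-* (a ∷ p) q = begin
    ev (addPoly R (scalePoly R a q) (R.0# ∷ mulPoly R p q))     ≈⟨ eval-+ (scalePoly R a q) _ ⟩
    ev (scalePoly R a q) + (f R.0# + x * ev (mulPoly R p q))
      ≈⟨ +-cong (eval-scale a q) (+-cong f.0#-homo (*-congˡ (eval-* p q))) ⟩
    f a * ev q + (0# + x * (ev p * ev q))
      ≈⟨ solve 4 (λ a x p q → a :* q :+ (con 0 :+ x :* (p :* q)) := (a :+ x :* p) :* q) refl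
           (f a) x (ev p) (ev q) ⟩
    (f a + x * ev p) * ev q                                     ∎

  eval-neg : ∀ p → ev (map R.-_ p) ≈ - ev p
  eval-neg []      = sym -0#≈0#
  eval-neg (a ∷ p) = begin
    f (R.- a) + x * ev (map R.-_ p)  ≈⟨ +-cong (f.-‿homo a) (*-congˡ (eval-neg p)) ⟩
    - f a + x * - ev p               ≈⟨ +-congˡ (-‿distribʳ-* x (ev p)) ⟨
    - f a + - (x * ev p)             ≈⟨ -‿+-comm (f a) (x * ev p) ⟩
    - (f a + x * ev p)               ∎

  eval-const : ∀ a → ev (a ∷ []) ≈ f a
  eval-const a = y≈0⇒x+y≈x (zeroʳ x)

  eval-X : ev (R.0# ∷ R.1# ∷ []) ≈ x
  eval-X = begin
    f R.0# + x * ev (R.1# ∷ [])  ≈⟨ +-cong f.0#-homo (*-congˡ (trans (eval-const R.1#) f.1#-homo)) ⟩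
    0# + x * 1#                  ≈⟨ +-identityˡ _ ⟩
    x * 1#                       ≈⟨ *-identityʳ x ⟩
    x                            ∎

  eval-isRingHomomorphism : IsRingHomomorphism (R [X]) rawRing ev
  eval-isRingHomomorphism = record
    { isSemiringHomomorphism = record
      { isNearSemiringHomomorphism = record
        { +-isMonoidHomomorphism = record
          { isMagmaHomomorphism = record
            { isRelHomomorphism = record { cong = eval-cong }
            ; homo = eval-+
            }
          ; ε-homo = refl
          }
        ; *-homo = eval-*
        }
      ; 1#-homo = trans (eval-const R.1#) f.1#-homo
      }
    ; -‿homo = eval-neg
    }

  eval-X^ : ∀ n → ev ((R.0# ∷ R.1# ∷ []) ^ₚ n) ≈ x ^ n
  eval-X^ zero    = trans (eval-const R.1#) f.1#-homo
  eval-X^ (suc n) = trans (eval-* (R.0# ∷ R.1# ∷ []) ((R.0# ∷ R.1# ∷ []) ^ₚ n)) (*-cong eval-X (eval-X^ n))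

eval-map : {A : Set c₁} {B : Set c₂} (S : RawRing c ℓ) (g : B → RawRing.Carrier S) (h : A → B)
           (x : RawRing.Carrier S) (p : List A) → eval S g x (map h p) ≡ eval S (g ∘ h) x p
eval-map S g h x []      = ≡.refl
eval-map S g h x (a ∷ p) = ≡.cong (λ e → g (h a) + x * e) (eval-map S g h x p)
  where open RawRing S

module _ (S : CommutativeRing c₁ ℓ₁) (T : CommutativeRing c₂ ℓ₂)
         {g : CommutativeRing.Carrier S → CommutativeRing.Carrier T}
         (g-isHom : IsRingHomomorphism (CommutativeRing.rawRing S) (CommutativeRing.rawRing T) g) where
  private
    module S = CommutativeRing S
    module g = IsRingHomomorphism g-isHom
  open CommutativeRing T hiding (zero)

  -- The coefficient map `f` is arbitrary and may itself be an evaluation, so nesting the lemma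
  -- gives the case of two variables.
  hom-eval : {A : Set a} (f : A → S.Carrier) {f′ : A → Carrier} → (∀ a → g (f a) ≈ f′ a) →
             ∀ {x y} → g x ≈ y → ∀ p → g (eval S.rawRing f x p) ≈ eval rawRing f′ y p
  hom-eval f f≈ gx≈y []      = g.0#-homo
  hom-eval f f≈ gx≈y (a ∷ p) =
    trans (g.+-homo _ _) (+-cong (f≈ a) (trans (g.*-homo _ _) (*-cong gx≈y (hom-eval f f≈ gx≈y p))))

-- The ring of dual numbers

module DualNumbers (K : CommutativeRing c ℓ) where
  open CommutativeRing K hiding (zero)
  open SemiringSolver commutativeSemiring
  open RingProperties ring using (-0#≈0#)
  private
    _*ε_ : Carrier × Carrier → Carrier × Carrier → Carrier × Carrier
    (a , b) *ε (c , d) = a * c , a * d + b * c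

  K[ε] : CommutativeRing c ℓ
  K[ε] = record
    { Carrier = Carrier × Carrier
    ; _*_ = _*ε_
    ; 1# = 1# , 0#
    ; isCommutativeRing = record
      { isRing = record
        { +-isAbelianGroup = AbelianGroup.isAbelianGroup
                               (DirectProduct.abelianGroup +-abelianGroup +-abelianGroup)
        ; *-cong = λ (p , q) (r , s) → *-cong p r , +-cong (*-cong p s) (*-cong q r)
        ; *-assoc = λ (a , b) (c , d) (e , f) → *-assoc a c e ,
            solve 6 (λ a b c d e f → (a :* c) :* f :+ (a :* d :+ b :* c) :* e
                                  := a :* (c :* f :+ d :* e) :+ b :* (c :* e)) refl a b c d e f
        ; *-identity =
            (λ (a , b) → *-identityˡ a , solve 2 (λ a b → con 1 :* b :+ con 0 :* a := b) refl a b) ,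
            (λ (a , b) → *-identityʳ a , solve 2 (λ a b → a :* con 0 :+ b :* con 1 := b) refl a b)
        ; distrib =
            (λ (a , b) (c , d) (e , f) → distribˡ a c e ,
              solve 6 (λ a b c d e f → a :* (d :+ f) :+ b :* (c :+ e)
                                    := (a :* d :+ b :* c) :+ (a :* f :+ b :* e)) refl a b c d e f) ,
            (λ (a , b) (c , d) (e , f) → distribʳ a c e ,
              solve 6 (λ a b c d e f → (c :+ e) :* b :+ (d :+ f) :* a
                                    := (c :* b :+ d :* a) :+ (e :* b :+ f :* a)) refl a b c d e f)
        }
      ; *-comm = λ (a , b) (c , d) → *-comm a c ,
          solve 4 (λ a b c d → a :* d :+ b :* c := c :* b :+ d :* a) refl a b c d
      }
    }

  private module K[ε] = CommutativeRing K[ε]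

  embed : Carrier → K[ε].Carrier
  embed a = a , 0#

  embed-isHom : IsRingHomomorphism rawRing K[ε].rawRing embed
  embed-isHom = record
    { isSemiringHomomorphism = record
      { isNearSemiringHomomorphism = record
        { +-isMonoidHomomorphism = record
          { isMagmaHomomorphism = record
            { isRelHomomorphism = record { cong = λ p → p , refl }
            ; homo = λ _ _ → refl , sym (+-identityˡ 0#)
            }
          ; ε-homo = refl , refl
          }
        ; *-homo = λ a b → refl , sym (solve 2 (λ a b → a :* con 0 :+ con 0 :* b := con 0) refl a b)
        }
      ; 1#-homo = refl , refl
      }
    ; -‿homo = λ _ → refl , sym -0#≈0#
    }

  proj₁-isHom : IsRingHomomorphism K[ε].rawRing rawRing proj₁
  proj₁-isHom = record
    { isSemiringHomomorphism = record
      { isNearSemiringHomomorphism = record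
        { +-isMonoidHomomorphism = record
          { isMagmaHomomorphism = record
            { isRelHomomorphism = record { cong = proj₁ }
            ; homo = λ _ _ → refl
            }
          ; ε-homo = refl
          }
        ; *-homo = λ _ _ → refl
        }
      ; 1#-homo = refl
      }
    ; -‿homo = λ _ → refl
    }

-- Synthetic division by X - ξ

module SyntheticDivision (R : CommutativeRing c ℓ) (ξ : CommutativeRing.Carrier R) where
  open CommutativeRing R hiding (zero)

  -- Horner's scheme: the coefficients of (p - p(ξ)) / (X - ξ) are the values at ξ of the successive
  -- tails of p. The last tail is empty, so a nonempty result ends in a harmless zero.
  quotient : List Carrier → List Carrier
  quotient []      = []
  quotient (a ∷ p) = eval rawRing id ξ p ∷ quotient p

  -- Comparison of the coefficients of X^(i+1) in p = p(ξ) + (X - ξ) q; the constant term is treated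
  -- in `eval-quotient`.
  coeff-quotient : ∀ p i → coeff rawRing (quotient p) i ≈
                   coeff rawRing p (suc i) + ξ * coeff rawRing (quotient p) (suc i)
  coeff-quotient []          i       = sym (trans (+-identityˡ _) (zeroʳ ξ))
  coeff-quotient (a ∷ [])    zero    = sym (trans (+-identityˡ _) (zeroʳ ξ))
  coeff-quotient (a ∷ b ∷ p) zero    = refl
  coeff-quotient (a ∷ p)     (suc i) = coeff-quotient p i

  eval-quotient : ∀ p → eval rawRing id ξ p ≈ coeff rawRing p 0 + ξ * coeff rawRing (quotient p) 0
  eval-quotient []      = sym (trans (+-identityˡ _) (zeroʳ ξ))
  eval-quotient (a ∷ p) = refl

  quotient-degree : ∀ m p → (∀ i → coeff rawRing p (suc m ℕ.+ i) ≈ 0#) →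
                    ∀ i → coeff rawRing (quotient p) (m ℕ.+ i) ≈ 0#
  quotient-degree m       []      h i       = refl
  quotient-degree zero    (a ∷ p) h zero    = Evaluation.eval-zero R (Identity.isRingHomomorphism rawRing refl) ξ p h
  quotient-degree zero    (a ∷ p) h (suc i) = quotient-degree zero p (h ∘ suc) i
  quotient-degree (suc m) (a ∷ p) h i       = quotient-degree m p h i

  module _ (S : CommutativeRing c₁ ℓ₁) {f : Carrier → CommutativeRing.Carrier S}
           (f-isHom : IsRingHomomorphism rawRing (CommutativeRing.rawRing S) f)
           (y : CommutativeRing.Carrier S) where
    private
      module S = CommutativeRing S
      module f = IsRingHomomorphism f-isHom
      ev = eval S.rawRing f y

    -- p = p(ξ) + (Y − ξ) q, with both sides moved so that no subtraction occurs.
    quotient-division : ∀ p → ev p S.+ f ξ S.* ev (quotient p) S.≈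
                        f (eval rawRing id ξ p) S.+ y S.* ev (quotient p)
    quotient-division []      = S.+-cong (S.sym f.0#-homo) (S.trans (S.zeroʳ _) (S.sym (S.zeroʳ _)))
    quotient-division (a ∷ p) = begin
      (f a S.+ y S.* ev p) S.+ f ξ S.* (f e S.+ y S.* q)
        ≈⟨ solve 6 (λ a y p x e q → (a :+ y :* p) :+ x :* (e :+ y :* q)
               := (a :+ x :* e) :+ y :* (p :+ x :* q)) S.refl (f a) y (ev p) (f ξ) (f e) q ⟩
      (f a S.+ f ξ S.* f e) S.+ y S.* (ev p S.+ f ξ S.* q)
        ≈⟨ S.+-cong (S.sym (S.trans (f.+-homo _ _) (S.+-congˡ (f.*-homo _ _)))) (S.*-congˡ (quotient-division p)) ⟩
      f (a + ξ * e) S.+ y S.* (f e S.+ y S.* q) ∎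
      where
      e = eval rawRing id ξ p
      q = ev (quotient p)
      open SemiringSolver S.commutativeSemiring
      open SetoidReasoning S.setoid

-- Arithmetic in a field

module FieldProperties (K : Field c ℓ) where
  open Field K hiding (zero)
  open ZeroProperties commutativeRing using (x≈0⇒x*y≈0; y≈0⇒x*y≈0)
  open SemiringSolver commutativeSemiring
  open SetoidReasoning setoid

  zero-product : ∀ {x y} → x * y ≈ 0# → x ≈ 0# ⊎ y ≈ 0#
  zero-product {x} {y} xy≈0 with x ≟ 0#
  ... | yes x≈0 = inj₁ x≈0
  ... | no  x≉0 = inj₂ (begin
    y                ≈⟨ *-identityˡ y ⟨
    1# * y           ≈⟨ *-congʳ (inverseʳ x x≉0) ⟨
    (x * x ⁻¹) * y   ≈⟨ solve 3 (λ x i y → (x :* i) :* y := i :* (x :* y)) refl x (x ⁻¹) y ⟩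
    x ⁻¹ * (x * y)   ≈⟨ *-congˡ xy≈0 ⟩
    x ⁻¹ * 0#        ≈⟨ zeroʳ _ ⟩
    0#               ∎)

  cancel-power : ∀ {y} → ¬ (y ≈ 0#) → ∀ n {t} → y ^ n * t ≈ 0# → t ≈ 0#
  cancel-power y≉0 zero    e = trans (sym (*-identityˡ _)) e
  cancel-power y≉0 (suc n) e with zero-product (trans (sym (*-assoc _ _ _)) e)
  ... | inj₁ y≈0 = contradiction y≈0 y≉0
  ... | inj₂ e′  = cancel-power y≉0 n e′

  vieta : ∀ {b c x y} → RootsOf K b c x y → b ≈ - (x + y) × c ≈ x * y
  vieta {b} {c} {x} {y} (mkEq coeffs) =
    trans (coeffs 1) (trans (+-cong (*-identityʳ _) (trans (+-identityʳ _) (*-identityˡ _))) (-‿+-comm x y)) ,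
    trans (coeffs 0) (trans (+-identityʳ _) (-x*-y≈x*y x y))
    where
    open RingProperties ring using (-‿+-comm; -‿distribˡ-*; -‿distribʳ-*; -‿involutive)
    -x*-y≈x*y : ∀ x y → - x * - y ≈ x * y
    -x*-y≈x*y x y = begin
      - x * - y      ≈⟨ -‿distribˡ-* x (- y) ⟨
      - (x * - y)    ≈⟨ -‿cong (-‿distribʳ-* x y) ⟨
      - - (x * y)    ≈⟨ -‿involutive _ ⟩
      x * y          ∎

  nonzero-factors : ∀ {c x y} → ¬ (c ≈ 0#) → c ≈ x * y → ¬ (x ≈ 0#) × ¬ (y ≈ 0#)
  nonzero-factors c≉0 c≈xy =
    (λ x≈0 → c≉0 (trans c≈xy (x≈0⇒x*y≈0 x≈0))) , (λ y≈0 → c≉0 (trans c≈xy (y≈0⇒x*y≈0 y≈0)))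

  quotient-inverse : ∀ {x y} → ¬ (x ≈ 0#) → ¬ (y ≈ 0#) → (x * y ⁻¹) * (y * x ⁻¹) ≈ 1#
  quotient-inverse {x} {y} x≉0 y≉0 = begin
    (x * y ⁻¹) * (y * x ⁻¹)
      ≈⟨ solve 4 (λ x y x′ y′ → (x :* y′) :* (y :* x′) := (x :* x′) :* (y :* y′)) refl
           x y (x ⁻¹) (y ⁻¹) ⟩
    (x * x ⁻¹) * (y * y ⁻¹)    ≈⟨ *-cong (inverseʳ x x≉0) (inverseʳ y y≉0) ⟩
    1# * 1#                    ≈⟨ *-identityˡ 1# ⟩
    1#                         ∎

  hom-reflects-0 : (L : Field c₁ ℓ₁) {f : Carrier → Field.Carrier L} → IsHom K L f →
                   ∀ {x} → Field._≈_ L (f x) (Field.0# L) → x ≈ 0#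
  hom-reflects-0 L {f} f-isHom {x} fx≈0 with x ≟ 0#
  ... | yes x≈0 = x≈0
  ... | no  x≉0 = contradiction
    (L.trans (L.sym f.1#-homo) (L.trans (f.⟦⟧-cong (sym (inverseʳ x x≉0)))
      (L.trans (f.*-homo _ _) (L.trans (L.*-congʳ fx≈0) (L.zeroˡ _)))))
    L.1≉0
    where
    module L = Field L
    module f = IsRingHomomorphism f-isHom

-- Correctness of division with remainder

module Division (F : Field c ℓ) where
  open Field F hiding (zero)
  open ZeroProperties commutativeRing using (y≈0⇒x*y≈0)
  open Cyclotomic F using (degree; divMod)
  open RingProperties ring using (-0#≈0#)
  private
    cf = coeff rawRing

  coeff-+ : ∀ p q i → cf (addPoly rawRing p q) i ≈ cf p i + cf q i
  coeff-+ []      q       i       = sym (+-identityˡ _)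
  coeff-+ (a ∷ p) []      i       = sym (+-identityʳ _)
  coeff-+ (a ∷ p) (b ∷ q) zero    = refl
  coeff-+ (a ∷ p) (b ∷ q) (suc i) = coeff-+ p q i

  coeff-neg-scale : ∀ s p i → cf (map -_ (scalePoly rawRing s p)) i ≈ - (s * cf p i)
  coeff-neg-scale s []      i       = sym (trans (-‿cong (zeroʳ s)) -0#≈0#)
  coeff-neg-scale s (a ∷ p) zero    = refl
  coeff-neg-scale s (a ∷ p) (suc i) = coeff-neg-scale s p i

  coeff-All : ∀ {p} → All (_≈ 0#) p → ∀ i → cf p i ≈ 0#
  coeff-All []       i       = refl
  coeff-All (a ∷ _)  zero    = a
  coeff-All (_ ∷ as) (suc i) = coeff-All as i

  leading-coeff : ∀ p → ¬ All (_≈ 0#) p → ¬ (cf p (degree p) ≈ 0#)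
  leading-coeff []      p≉0 = contradiction [] p≉0
  leading-coeff (a ∷ p) ap≉0 with all? (_≟ 0#) p
  ... | yes p≈0 = λ a≈0 → ap≉0 (a≈0 ∷ p≈0)
  ... | no  p≉0 = leading-coeff p p≉0

  coeff->degree : ∀ p i → cf p (suc (degree p) ℕ.+ i) ≈ 0#
  coeff->degree []      i = refl
  coeff->degree (a ∷ p) i with all? (_≟ 0#) p
  ... | yes p≈0 = coeff-All p≈0 i
  ... | no  _   = coeff->degree p i

  -- With m = deg g, the coefficient of X^m is cancelled by the choice of `s`, as the leading
  -- coefficient of g is invertible. Above X^m both terms vanish: a + X r has degree at most m by
  -- induction, and g has degree m.
  remainder-degree : ∀ g → ¬ All (_≈ 0#) g → ∀ p i → cf (proj₂ (divMod p g)) (degree g ℕ.+ i) ≈ 0#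
  remainder-degree g g≉0 []      i = refl
  remainder-degree g g≉0 (a ∷ p) i with divMod p g | remainder-degree g g≉0 p
  ... | q , r | r-degree = trans (coeff-+ (a ∷ r) (map -_ (scalePoly rawRing s g)) (m ℕ.+ i))
    (trans (+-congˡ (coeff-neg-scale s g _)) (go i))
    where
    open SetoidReasoning setoid
    open SemiringSolver commutativeSemiring
    m = degree g
    l = cf g m
    s = cf (a ∷ r) m * l ⁻¹
    go : ∀ i → cf (a ∷ r) (m ℕ.+ i) + - (s * cf g (m ℕ.+ i)) ≈ 0#
    go zero rewrite ℕ.+-identityʳ m = begin
      cf (a ∷ r) m + - (cf (a ∷ r) m * l ⁻¹ * l)
        ≈⟨ +-congˡ (-‿cong (solve 3 (λ t i l → t :* i :* l := t :* (l :* i)) refl (cf (a ∷ r) m) (l ⁻¹) l)) ⟩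
      cf (a ∷ r) m + - (cf (a ∷ r) m * (l * l ⁻¹))
        ≈⟨ +-congˡ (-‿cong (trans (*-congˡ (inverseʳ l (leading-coeff g g≉0))) (*-identityʳ _))) ⟩
      cf (a ∷ r) m + - cf (a ∷ r) m                 ≈⟨ -‿inverseʳ _ ⟩
      0#                                            ∎
    go (suc i) rewrite ℕ.+-suc m i = begin
      cf r (m ℕ.+ i) + - (s * cf g (suc m ℕ.+ i))
        ≈⟨ +-cong (r-degree i) (-‿cong (y≈0⇒x*y≈0 (coeff->degree g i))) ⟩
      0# + - 0#                                     ≈⟨ -‿inverseʳ 0# ⟩
      0#                                            ∎

  module _ (S : CommutativeRing c₁ ℓ₁) {f : Carrier → CommutativeRing.Carrier S}
           (f-isHom : IsRingHomomorphism rawRing (CommutativeRing.rawRing S) f)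
           (x : CommutativeRing.Carrier S) where
    private module S = CommutativeRing S
    open Evaluation S f-isHom x
    open SetoidReasoning S.setoid
    open SemiringSolver S.commutativeSemiring
    private ev = eval S.rawRing f x

    -- Whatever the scalar `s` is, the multiple s g that enters with the quotient is subtracted
    -- again in the remainder. So the identity holds for every g; the choice of `s` matters for the
    -- degree of the remainder.
    divMod-eval : ∀ g p → ev p S.≈ ev (proj₁ (divMod p g)) S.* ev g S.+ ev (proj₂ (divMod p g))
    divMod-eval g []      = S.sym (S.trans (S.+-identityʳ _) (S.zeroˡ _))
    divMod-eval g (a ∷ p) with divMod p g | divMod-eval g p
    ... | q , r | p≈qg+r = begin
      f a S.+ x S.* ev p
        ≈⟨ S.+-congˡ (S.*-congˡ p≈qg+r) ⟩
      f a S.+ x S.* (ev q S.* ev g S.+ ev r)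
        ≈⟨ S.+-identityʳ _ ⟨
      f a S.+ x S.* (ev q S.* ev g S.+ ev r) S.+ S.0#
        ≈⟨ S.+-congˡ (S.-‿inverseʳ _) ⟨
      f a S.+ x S.* (ev q S.* ev g S.+ ev r) S.+ (f s S.* ev g S.+ S.- (f s S.* ev g))
        ≈⟨ solve 7 (λ a x q g r s n → a :+ x :* (q :* g :+ r) :+ (s :* g :+ n)
               := (s :+ x :* q) :* g :+ ((a :+ x :* r) :+ n)) S.refl
             (f a) x (ev q) (ev g) (ev r) (f s) (S.- (f s S.* ev g)) ⟩
      (f s S.+ x S.* ev q) S.* ev g S.+ ((f a S.+ x S.* ev r) S.+ S.- (f s S.* ev g))
        ≈⟨ S.+-congˡ (S.+-congˡ (S.trans (eval-neg (scalePoly rawRing s g)) (S.-‿cong (eval-scale s g)))) ⟨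
      (f s S.+ x S.* ev q) S.* ev g S.+ ((f a S.+ x S.* ev r) S.+ ev (map -_ (scalePoly rawRing s g)))
        ≈⟨ S.+-congˡ (eval-+ (a ∷ r) (map -_ (scalePoly rawRing s g))) ⟨
      (f s S.+ x S.* ev q) S.* ev g S.+ ev (addPoly rawRing (a ∷ r) (map -_ (scalePoly rawRing s g))) ∎
      where
      s = cf (a ∷ r) (degree g) * cf g (degree g) ⁻¹

-- Simple roots and divisibility over an algebraically closed field

module SimpleRoots (K : Field c ℓ) where
  open Field K hiding (zero)
  open ZeroProperties commutativeRing using (y≈0⇒x*y≈0; x≈0⇒x+y≈y; y≈0⇒x+y≈x)
  open DualNumbers commutativeRing
  open FieldProperties K
  open MultProperties semiring using (×-comm-*; ×-congʳ)
  open RingProperties ring using (+-cancelˡ; [y-z]x≈yx-zx; x≈y⇒x∙y⁻¹≈ε; x∙y⁻¹≈ε⇒x≈y)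
  open RawSemiringDefinitions (RawRing.rawSemiring rawRing) using () renaming (_×_ to _·_)
  private
    module K[ε] = CommutativeRing K[ε]
    cf = coeff rawRing
  open RawSemiringDefinitions (RawRing.rawSemiring K[ε].rawRing) using () renaming (_^_ to _^ε_)

  -- p(ξ + ε) = p(ξ) + p′(ξ) ε vanishes exactly when ξ is a multiple root of p.
  Simple : {A : Set a} → (A → Carrier) → List A → Set (c ⊔ ℓ)
  Simple f p = ∀ ξ → ¬ (eval K[ε].rawRing (embed ∘ f) (ξ , 1#) p K[ε].≈ K[ε].0#)

  real-part : {A : Set a} (f : A → Carrier) (ξ : Carrier) (p : List A) →
              proj₁ (eval K[ε].rawRing (embed ∘ f) (ξ , 1#) p) ≈ eval rawRing f ξ p
  real-part f ξ = hom-eval K[ε] commutativeRing proj₁-isHom (embed ∘ f) (λ _ → refl) refl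

  -- The ε-part of (ξ + ε)ⁿ is n ξⁿ⁻¹; the extra factor ξ avoids the exponent n - 1.
  power-dual : ∀ ξ n → proj₁ ((ξ , 1#) ^ε n) ≈ ξ ^ n × ξ * proj₂ ((ξ , 1#) ^ε n) ≈ n · (ξ ^ n)
  power-dual ξ zero    = refl , zeroʳ ξ
  power-dual ξ (suc n) with power-dual ξ n
  ... | re , im = *-congˡ re , (begin
    ξ * (ξ * proj₂ z + 1# * proj₁ z)      ≈⟨ *-congˡ (+-cong im (trans (*-identityˡ _) re)) ⟩
    ξ * (n · (ξ ^ n) + ξ ^ n)             ≈⟨ distribˡ ξ _ _ ⟩
    ξ * (n · (ξ ^ n)) + ξ * ξ ^ n         ≈⟨ +-congʳ (×-comm-* n ξ (ξ ^ n)) ⟩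
    n · (ξ * ξ ^ n) + ξ * ξ ^ n           ≈⟨ +-comm _ _ ⟩
    ξ * ξ ^ n + n · (ξ * ξ ^ n)           ∎)
    where
    open SetoidReasoning setoid
    z = (ξ , 1#) ^ε n

  -- Separability of Xⁿ - 1: if ξ + ε were an n-th root of unity, its real part would give ξⁿ = 1
  -- and its ε-part n ξⁿ = 0, hence n = 0.
  roots-of-unity-simple : ∀ n → ¬ (n · 1# ≈ 0#) → ∀ ξ → ¬ ((ξ , 1#) ^ε n K[ε].≈ K[ε].1#)
  roots-of-unity-simple n n≉0 ξ (re≈1 , im≈0) = n≉0 (begin
    n · 1#
      ≈⟨ ×-congʳ n (trans (sym re≈1) (proj₁ pd)) ⟩
    n · (ξ ^ n)                         ≈⟨ proj₂ pd ⟨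
    ξ * proj₂ ((ξ , 1#) ^ε n)           ≈⟨ *-congˡ im≈0 ⟩
    ξ * 0#                              ≈⟨ zeroʳ ξ ⟩
    0#                                  ∎)
    where
    open SetoidReasoning setoid
    pd = power-dual ξ n

  private
    sum-zero : ∀ {u v w : Carrier} → u ≈ 0# → u + v ≈ 0# + w → v ≈ w
    sum-zero u≈0 e = trans (sym (x≈0⇒x+y≈y u≈0)) (trans e (+-identityˡ _))

    cancel : ∀ {ξ η d} → ¬ (η ≈ ξ) → ξ * d ≈ η * d → d ≈ 0#
    cancel {ξ} {η} {d} η≉ξ e with zero-product (trans ([y-z]x≈yx-zx d η ξ) (x≈y⇒x∙y⁻¹≈ε (sym e)))
    ... | inj₁ η-ξ≈0 = contradiction (x∙y⁻¹≈ε⇒x≈y η ξ η-ξ≈0) η≉ξ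
    ... | inj₂ d≈0   = d≈0

  IsAlgebraicallyClosed : Set (c ⊔ ℓ)
  IsAlgebraicallyClosed = ∀ p → (∃ λ i → ¬ (cf p (suc i) ≈ 0#)) → ∃ λ x → eval rawRing id x p ≈ 0#

  module _ (isClosed : IsAlgebraicallyClosed) where

    -- A root ξ of g splits off from both g and r; as it is simple, the remaining roots
    -- of g differ from ξ, so they are roots of what remains of r.
    remainder-zero : ∀ m g r → ¬ (cf g m ≈ 0#) → (∀ i → cf g (suc m ℕ.+ i) ≈ 0#) → Simple id g →
                     (∀ ξ → eval rawRing id ξ g ≈ 0# → eval rawRing id ξ r ≈ 0#) →
                     (∀ i → cf r (m ℕ.+ i) ≈ 0#) → ∀ i → cf r i ≈ 0#
    remainder-zero zero    g r lead top simple roots r-deg = r-deg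
    remainder-zero (suc m) g r lead top simple roots r-deg with isClosed g (m , lead)
    ... | ξ , gξ≈0 = r≈0
      where
      open SyntheticDivision commutativeRing ξ
      open SetoidReasoning setoid
      g′ = quotient g
      r′ = quotient r
      id-isHom = Identity.isRingHomomorphism rawRing refl
      rξ≈0 = roots ξ gξ≈0

      g′-top : ∀ i → cf g′ (suc m ℕ.+ i) ≈ 0#
      g′-top = quotient-degree (suc m) g top

      g′-lead : ¬ (cf g′ m ≈ 0#)
      g′-lead g′m≈0 = lead (begin
        cf g (suc m)
          ≈⟨ y≈0⇒x+y≈x (y≈0⇒x*y≈0 (≡.subst (λ k → cf g′ (suc k) ≈ 0#) (ℕ.+-identityʳ m) (g′-top 0))) ⟨
        cf g (suc m) + ξ * cf g′ (suc m)    ≈⟨ coeff-quotient g m ⟨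
        cf g′ m                             ≈⟨ g′m≈0 ⟩
        0#                                  ∎)

      ev : Carrier → List Carrier → Carrier
      ev = eval rawRing id

      evε : Carrier → List Carrier → K[ε].Carrier
      evε η = eval K[ε].rawRing embed (η , 1#)

      dual-division : ∀ η → evε η g K[ε].+ embed ξ K[ε].* evε η g′ K[ε].≈ (η , 1#) K[ε].* evε η g′
      dual-division η = K[ε].trans (quotient-division K[ε] embed-isHom (η , 1#) g)
        (K[ε].trans (K[ε].+-congʳ (gξ≈0 , refl)) (K[ε].+-identityˡ _))

      g′-simple : Simple id g′
      g′-simple η g′≈0 = simple η (K[ε].trans (K[ε].sym (K[ε].+-identityʳ _))
        (K[ε].trans (K[ε].+-congˡ (K[ε].sym (K[ε].trans (K[ε].*-congˡ g′≈0) (K[ε].zeroʳ (embed ξ)))))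
        (K[ε].trans (dual-division η) (K[ε].trans (K[ε].*-congˡ g′≈0) (K[ε].zeroʳ (η , 1#))))))

      division : ∀ η p → ev ξ p ≈ 0# →
                 ev η p + ξ * ev η (quotient p) ≈ 0# + η * ev η (quotient p)
      division η p pξ≈0 = trans (quotient-division commutativeRing id-isHom η p) (+-congʳ pξ≈0)

      -- Here `g′` is the quotient of g by X - ξ, not its derivative. For η = ξ the linear factor
      -- takes the value ε at η + ε, so g takes the value ε g′(ξ) there, which would be 0 and make ξ
      -- a double root of g.
      root≉ξ : ∀ η → ev η g′ ≈ 0# → ¬ (η ≈ ξ)
      root≉ξ η g′η≈0 η≈ξ = simple η (gη≈0 , im≈0)
        where
        e = evε η g
        e′ = evε η g′
        e′₁≈0 : proj₁ e′ ≈ 0#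
        e′₁≈0 = trans (real-part id η g′) g′η≈0
        gη≈0 : proj₁ e ≈ 0#
        gη≈0 = begin
          proj₁ e                     ≈⟨ y≈0⇒x+y≈x (y≈0⇒x*y≈0 e′₁≈0) ⟨
          proj₁ e + ξ * proj₁ e′      ≈⟨ proj₁ (dual-division η) ⟩
          η * proj₁ e′                ≈⟨ y≈0⇒x*y≈0 e′₁≈0 ⟩
          0#                          ∎
        im≈0 : proj₂ e ≈ 0#
        im≈0 = +-cancelˡ (ξ * proj₂ e′) (proj₂ e) 0# (begin
          ξ * proj₂ e′ + proj₂ e                         ≈⟨ +-comm _ _ ⟩
          proj₂ e + ξ * proj₂ e′                         ≈⟨ +-congˡ (y≈0⇒x+y≈x (zeroˡ _)) ⟨
          proj₂ e + (ξ * proj₂ e′ + 0# * proj₁ e′)       ≈⟨ proj₂ (dual-division η) ⟩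
          η * proj₂ e′ + 1# * proj₁ e′
            ≈⟨ +-cong (*-congʳ η≈ξ) (trans (*-identityˡ _) e′₁≈0) ⟩
          ξ * proj₂ e′ + 0#                              ∎)

      r′-roots : ∀ η → ev η g′ ≈ 0# → ev η r′ ≈ 0#
      r′-roots η g′η≈0 = cancel (root≉ξ η g′η≈0) (sum-zero (roots η gη≈0) (division η r rξ≈0))
        where
        gη≈0 : ev η g ≈ 0#
        gη≈0 = begin
          ev η g                  ≈⟨ y≈0⇒x+y≈x (y≈0⇒x*y≈0 g′η≈0) ⟨
          ev η g + ξ * ev η g′    ≈⟨ division η g gξ≈0 ⟩
          0# + η * ev η g′        ≈⟨ +-identityˡ _ ⟩
          η * ev η g′             ≈⟨ y≈0⇒x*y≈0 g′η≈0 ⟩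
          0#                      ∎

      r′≈0 : ∀ i → cf r′ i ≈ 0#
      r′≈0 = remainder-zero m g′ r′ g′-lead g′-top g′-simple r′-roots (quotient-degree m r r-deg)

      r≈0 : ∀ i → cf r i ≈ 0#
      r≈0 zero    = begin
        cf r 0                     ≈⟨ y≈0⇒x+y≈x (y≈0⇒x*y≈0 (r′≈0 0)) ⟨
        cf r 0 + ξ * cf r′ 0       ≈⟨ eval-quotient r ⟨
        eval rawRing id ξ r        ≈⟨ rξ≈0 ⟩
        0#                         ∎
      r≈0 (suc i) = begin
        cf r (suc i)                         ≈⟨ y≈0⇒x+y≈x (y≈0⇒x*y≈0 (r′≈0 (suc i))) ⟨
        cf r (suc i) + ξ * cf r′ (suc i)     ≈⟨ coeff-quotient r i ⟨
        cf r′ i                              ≈⟨ r′≈0 i ⟩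
        0#                                   ∎

-- Multiplicative order

module Order (K : Field c ℓ) where
  open Field K hiding (zero)
  open ExpProperties semiring using (^-homo-*; ^-assocʳ; ^-congˡ)
  open CommutativeExpProperties commutativeSemiring using (^-distrib-*)

  one^ : ∀ n → 1# ^ n ≈ 1#
  one^ zero    = refl
  one^ (suc n) = trans (*-identityˡ _) (one^ n)

  order-unique : ∀ {ξ m n} → HasOrder K ξ m → HasOrder K ξ n → m ≡ n
  order-unique {m = m} {n} (1≤m , ξᵐ≈1 , m-least) (1≤n , ξⁿ≈1 , n-least) with ℕ.<-cmp m n
  ... | tri< m<n _ _ = contradiction ξᵐ≈1 (n-least m 1≤m m<n)
  ... | tri≈ _ m≡n _ = m≡n
  ... | tri> _ _ n<m = contradiction ξⁿ≈1 (m-least n 1≤n n<m)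

  order-divides : ∀ {ξ d n} → HasOrder K ξ d → ξ ^ n ≈ 1# → d ∣ n
  order-divides {ξ} {suc k} {n} (_ , ξᵈ≈1 , least) ξⁿ≈1 =
    m%n≡0⇒n∣m n d (remainder (n % d) (m%n<n n d) (begin
    ξ ^ (n % d)                          ≈⟨ *-identityʳ _ ⟨
    ξ ^ (n % d) * 1#                     ≈⟨ *-congˡ (one^ (n / d)) ⟨
    ξ ^ (n % d) * 1# ^ (n / d)           ≈⟨ *-congˡ (^-congˡ (n / d) ξᵈ≈1) ⟨
    ξ ^ (n % d) * (ξ ^ d) ^ (n / d)      ≈⟨ *-congˡ (^-assocʳ ξ d (n / d)) ⟩
    ξ ^ (n % d) * ξ ^ (d ℕ.* (n / d))    ≈⟨ ^-homo-* ξ (n % d) _ ⟨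
    ξ ^ (n % d ℕ.+ d ℕ.* (n / d))
      ≡⟨ ≡.cong (ξ ^_) (≡.trans (≡.cong (n % d ℕ.+_) (ℕ.*-comm d (n / d)))
                                (≡.sym (m≡m%n+[m/n]*n n d))) ⟩
    ξ ^ n                                ≈⟨ ξⁿ≈1 ⟩
    1#                                   ∎))
    where
    open SetoidReasoning setoid
    d = suc k
    remainder : ∀ r → r ℕ.< d → ξ ^ r ≈ 1# → r ≡ 0
    remainder zero    _   _    = ≡.refl
    remainder (suc r) r<d ξʳ≈1 = contradiction ξʳ≈1 (least (suc r) (ℕ.s≤s ℕ.z≤n) r<d)

  -- A bounded search: the right alternative records that all exponents so far have failed, so the
  -- first success is automatically minimal.
  order-exists : ∀ ξ n → (∃ λ d → HasOrder K ξ d) ⊎ (∀ m → 1 ≤ m → m ≤ n → ¬ (ξ ^ m ≈ 1#))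
  order-exists ξ zero = inj₂ (λ m 1≤m m≤0 → contradiction (ℕ.≤-trans 1≤m m≤0) λ ())
  order-exists ξ (suc n) with order-exists ξ n | ξ ^ suc n ≟ 1#
  ... | inj₁ d    | _        = inj₁ d
  ... | inj₂ none | yes ξˢ≈1 = inj₁ (suc n , ℕ.s≤s ℕ.z≤n , ξˢ≈1 , λ m 1≤m m<s → none m 1≤m (ℕ.≤-pred m<s))
  ... | inj₂ none | no  ξˢ≉1 = inj₂ go
    where
    go : ∀ m → 1 ≤ m → m ≤ suc n → ¬ (ξ ^ m ≈ 1#)
    go m 1≤m m≤s with ℕ.m≤n⇒m<n∨m≡n m≤s
    ... | inj₁ m<s    = none m 1≤m (ℕ.≤-pred m<s)
    ... | inj₂ ≡.refl = ξˢ≉1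

  finite-order : ∀ {ξ n} → 1 ≤ n → ξ ^ n ≈ 1# → ∃ λ d → HasOrder K ξ d
  finite-order {ξ} {n} 1≤n ξⁿ≈1 with order-exists ξ n
  ... | inj₁ d    = d
  ... | inj₂ none = contradiction ξⁿ≈1 (none n 1≤n ℕ.≤-refl)

  power-divides : ∀ {ξ d n} → d ∣ n → ξ ^ d ≈ 1# → ξ ^ n ≈ 1#
  power-divides {ξ} {d} (divides k ≡.refl) ξᵈ≈1 = begin
    ξ ^ (k ℕ.* d)   ≡⟨ ≡.cong (ξ ^_) (ℕ.*-comm k d) ⟩
    ξ ^ (d ℕ.* k)   ≈⟨ ^-assocʳ ξ d k ⟨
    (ξ ^ d) ^ k     ≈⟨ ^-congˡ k ξᵈ≈1 ⟩
    1# ^ k          ≈⟨ one^ k ⟩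
    1#              ∎
    where open SetoidReasoning setoid

  order-inverse : ∀ {u v n} → u * v ≈ 1# → HasOrder K u n → HasOrder K v n
  order-inverse {n = n} uv≈1 (1≤n , uⁿ≈1 , least) =
    1≤n , power uv≈1 n uⁿ≈1 , λ m 1≤m m<n vᵐ≈1 → least m 1≤m m<n (power (trans (*-comm _ _) uv≈1) m vᵐ≈1)
    where
    power : ∀ {u v} → u * v ≈ 1# → ∀ m → u ^ m ≈ 1# → v ^ m ≈ 1#
    power {u} {v} uv≈1 m uᵐ≈1 = begin
      v ^ m            ≈⟨ *-identityˡ _ ⟨
      1# * v ^ m       ≈⟨ *-congʳ uᵐ≈1 ⟨
      u ^ m * v ^ m    ≈⟨ ^-distrib-* u v m ⟨
      (u * v) ^ m      ≈⟨ ^-congˡ m uv≈1 ⟩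
      1# ^ m           ≈⟨ one^ m ⟩
      1#               ∎
      where open SetoidReasoning setoid

-- Proper divisors and the recursion that defines Φₙ

∈-properDivisors⁺ : ∀ {d n} → 1 ≤ d → d ℕ.< n → d ∣ n → d ∈ properDivisors n
∈-properDivisors⁺ {suc d} {suc n} _ (ℕ.s≤s d<n) d∣n = ∈-filter⁺ (_∣? suc n) (∈-applyUpTo⁺ suc d<n) d∣n

∈-properDivisors⁻ : ∀ {d n} → 1 ≤ n → d ∈ properDivisors n → 1 ≤ d × d ℕ.< n × d ∣ n
∈-properDivisors⁻ {n = suc n} _ d∈ with ∈-filter⁻ (_∣? suc n) {xs = applyUpTo suc n} d∈
... | d∈′ , d∣n with ∈-applyUpTo⁻ suc d∈′
...   | i , i<n , ≡.refl = ℕ.s≤s ℕ.z≤n , ℕ.s≤s i<n , d∣n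

properDivisors-unique : ∀ n → Unique (properDivisors n)
properDivisors-unique n = filter⁺ (_∣? n) (applyUpTo⁺₁ suc (ℕ.pred n) (λ i<j _ → ℕ.<⇒≢ (ℕ.s≤s i<j)))

module CyclotomicRecursion (F : Field c ℓ) where
  open Field F using (rawRing)
  open Cyclotomic F using (Φ<; nextΦ; divMod; X^_−1)

  productΦ : List ℕ → List (Field.Carrier F)
  productΦ ds = foldr (mulPoly rawRing) (RawRing.1# (rawRing [X])) (map (Φ F) ds)

  private
    Φ<-latest : ∀ n → Φ F n ≡ nextΦ n (Φ< n)
    Φ<-latest n rewrite Equivalence.to T-≡ (ℕ.≡⇒≡ᵇ n n ≡.refl) = ≡.refl

    Φ<-earlier : ∀ {d} n → d ℕ.< n → Φ< (suc n) d ≡ Φ< n d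
    Φ<-earlier {d} n d<n with d ℕ.≡ᵇ n in eq
    ... | false = ≡.refl
    ... | true  = contradiction (ℕ.≡ᵇ⇒≡ d n (Equivalence.from T-≡ eq)) (ℕ.<⇒≢ d<n)

    -- Stage n + 1 of the table changes the entry at n only, so the entry at d is final from stage d
    -- + 1 on.
    Φ<-stable : ∀ {d} n → d ℕ.< n → Φ< n d ≡ Φ F d
    Φ<-stable (suc n) (ℕ.s≤s d≤n) with ℕ.m≤n⇒m<n∨m≡n d≤n
    ... | inj₁ d<n    = ≡.trans (Φ<-earlier n d<n) (Φ<-stable n d<n)
    ... | inj₂ ≡.refl = ≡.refl

  Φ-unfold : ∀ {n} → 1 ≤ n → Φ F n ≡ proj₁ (divMod (X^ n −1) (productΦ (properDivisors n)))
  Φ-unfold {n} 1≤n = ≡.trans (Φ<-latest n)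
    (≡.cong (λ Φs → proj₁ (divMod (X^ n −1) (foldr (mulPoly rawRing) (RawRing.1# (rawRing [X])) Φs)))
      (map-cong-local (All.tabulate λ d∈ → Φ<-stable n (proj₁ (proj₂ (∈-properDivisors⁻ 1≤n d∈))))))

-- The roots of the cyclotomic polynomials

module CyclotomicRoots
  (F : Field c₁ ℓ₁) (K : Field c₂ ℓ₂) (isClosed : SimpleRoots.IsAlgebraicallyClosed K)
  {ι : Field.Carrier F → Field.Carrier K} (ι-isHom : IsHom F K ι)
  where
  open Field K hiding (zero)
  open ZeroProperties commutativeRing using (x≈0⇒x*y≈0; y≈0⇒x*y≈0; x≈0⇒x+y≈y; y≈0⇒x+y≈x)
  open DualNumbers commutativeRing
  open SimpleRoots K
  open FieldProperties K using (zero-product)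
  open Order K
  open CyclotomicRecursion F
  open Division F
  open Cyclotomic F using (divMod; degree; X^_−1)
  open MultProperties semiring using (×1-homo-*)
  open RingProperties ring using (x∙y⁻¹≈ε⇒x≈y; x≈y⇒x∙y⁻¹≈ε)
  open RawSemiringDefinitions (RawRing.rawSemiring rawRing) using () renaming (_×_ to _·_)
  private
    module F = Field F
    module K[ε] = CommutativeRing K[ε]
    module ι = IsRingHomomorphism ι-isHom
    mul = mulPoly F.rawRing

    ι-isHomε : IsRingHomomorphism F.rawRing K[ε].rawRing (embed ∘ ι)
    ι-isHomε = isRingHomomorphism K[ε].trans ι-isHom embed-isHom

  open RawSemiringDefinitions (RawRing.rawSemiring K[ε].rawRing) using () renaming (_^_ to _^ε_)

  infix 5 _⟨_⟩ _⟨_+ε⟩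
  _⟨_⟩ : List F.Carrier → Carrier → Carrier
  p ⟨ ξ ⟩ = eval rawRing ι ξ p

  _⟨_+ε⟩ : List F.Carrier → Carrier → K[ε].Carrier
  p ⟨ ξ +ε⟩ = eval K[ε].rawRing (embed ∘ ι) (ξ , 1#) p

  coeff-map : ∀ p i → coeff rawRing (map ι p) i ≈ ι (coeff F.rawRing p i)
  coeff-map []      i       = sym ι.0#-homo
  coeff-map (a ∷ p) zero    = refl
  coeff-map (a ∷ p) (suc i) = coeff-map p i

  ι-reflects-0 : ∀ {a} → ι a ≈ 0# → a F.≈ F.0#
  ι-reflects-0 = FieldProperties.hom-reflects-0 F K ι-isHom

  real≈0 : ∀ {p ξ} → p ⟨ ξ ⟩ ≈ 0# → proj₁ (p ⟨ ξ +ε⟩) ≈ 0#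
  real≈0 {p} {ξ} pξ≈0 = trans (real-part ι ξ p) pξ≈0

  eval-product : ∀ p q ξ → mul p q ⟨ ξ ⟩ ≈ (p ⟨ ξ ⟩) * (q ⟨ ξ ⟩)
  eval-product p q ξ = Evaluation.eval-* commutativeRing ι-isHom ξ p q

  -- By the product rule the ε-part of the value is p q′ + p′ q. At a root of p only p′ q is left,
  -- whose factors are nonzero because p is simple and q has no root in common with p; roots of q
  -- are symmetric.
  simple-product : ∀ {p q} → Simple ι p → Simple ι q →
                   (∀ ξ → p ⟨ ξ ⟩ ≈ 0# → ¬ (q ⟨ ξ ⟩ ≈ 0#)) → Simple ι (mul p q)
  simple-product {p} {q} p-simple q-simple disjoint ξ pq≈0
    with K[ε].trans (K[ε].sym (Evaluation.eval-* K[ε] ι-isHomε (ξ , 1#) p q)) pq≈0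
  ... | re≈0 , im≈0 with zero-product re≈0
  ...   | inj₁ p₁≈0 = case-p (zero-product (trans (sym (x≈0⇒x+y≈y (x≈0⇒x*y≈0 p₁≈0))) im≈0))
    where
    case-p : proj₂ (p ⟨ ξ +ε⟩) ≈ 0# ⊎ proj₁ (q ⟨ ξ +ε⟩) ≈ 0# → ⊥
    case-p (inj₁ p₂≈0) = p-simple ξ (p₁≈0 , p₂≈0)
    case-p (inj₂ q₁≈0) = disjoint ξ (trans (sym (real-part ι ξ p)) p₁≈0) (trans (sym (real-part ι ξ q)) q₁≈0)
  ...   | inj₂ q₁≈0 = case-q (zero-product (trans (sym (y≈0⇒x+y≈x (y≈0⇒x*y≈0 q₁≈0))) im≈0))
    where
    case-q : proj₁ (p ⟨ ξ +ε⟩) ≈ 0# ⊎ proj₂ (q ⟨ ξ +ε⟩) ≈ 0# → ⊥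
    case-q (inj₁ p₁≈0) = disjoint ξ (trans (sym (real-part ι ξ p)) p₁≈0) (trans (sym (real-part ι ξ q)) q₁≈0)
    case-q (inj₂ q₂≈0) = q-simple ξ (q₁≈0 , q₂≈0)

  simple⇒nonzero : ∀ {g} → Simple ι g → ¬ All (F._≈ F.0#) g
  simple⇒nonzero {g} simple g≈0 = simple 0#
    (Evaluation.eval-zero K[ε] ι-isHomε (0# , 1#) g (λ i → trans (ι.⟦⟧-cong (coeff-All g≈0 i)) ι.0#-homo , refl))

  module _ {g h : List F.Carrier} (g-simple : Simple ι g)
           (roots : ∀ ξ → g ⟨ ξ ⟩ ≈ 0# → h ⟨ ξ ⟩ ≈ 0#) where
    private
      q = proj₁ (divMod h g)
      r = proj₂ (divMod h g)
      g≉0 = simple⇒nonzero {g} g-simple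

      r-roots : ∀ ξ → g ⟨ ξ ⟩ ≈ 0# → r ⟨ ξ ⟩ ≈ 0#
      r-roots ξ gξ≈0 = begin
        r ⟨ ξ ⟩                            ≈⟨ +-identityˡ _ ⟨
        0# + (r ⟨ ξ ⟩)                     ≈⟨ +-congʳ (y≈0⇒x*y≈0 gξ≈0) ⟨
        (q ⟨ ξ ⟩) * (g ⟨ ξ ⟩) + (r ⟨ ξ ⟩)  ≈⟨ divMod-eval commutativeRing ι-isHom ξ g h ⟨
        h ⟨ ξ ⟩                            ≈⟨ roots ξ gξ≈0 ⟩
        0#                                 ∎
        where open SetoidReasoning setoid

      lift-coeff : ∀ p i → coeff F.rawRing p i F.≈ F.0# → coeff rawRing (map ι p) i ≈ 0#
      lift-coeff p i pᵢ≈0 = trans (coeff-map p i) (trans (ι.⟦⟧-cong pᵢ≈0) ι.0#-homo)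

      -- The roots of g lie in K, so `remainder-zero` is applied to the images of `g` and `r` over
      -- K; injectivity of `ι` brings the conclusion back to F.
      r≈0 : ∀ i → coeff F.rawRing r i F.≈ F.0#
      r≈0 i = ι-reflects-0 (trans (sym (coeff-map r i)) 
        (remainder-zero isClosed (degree g) (map ι g) (map ι r)
        (λ lead≈0 → leading-coeff g g≉0 (ι-reflects-0 (trans (sym (coeff-map g (degree g))) lead≈0)))
        (λ i → lift-coeff g _ (coeff->degree g i))
        (λ ξ e → g-simple ξ (≡.subst (K[ε]._≈ K[ε].0#) (eval-map K[ε].rawRing embed ι (ξ , 1#) g) e))
        (λ ξ e → ≡.subst (_≈ 0#) (≡.sym (eval-map rawRing id ι ξ r))
          (r-roots ξ (≡.subst (_≈ 0#) (eval-map rawRing id ι ξ g) e)))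
        (λ i → lift-coeff r _ (remainder-degree g g≉0 h i)) i))

    -- Because the remainder vanishes over F itself, the factorization is valid in every commutative
    -- ring that receives F, in particular in K and in K[ε].
    exact-division : (S : CommutativeRing c ℓ) (let module S = CommutativeRing S)
                     {f : F.Carrier → S.Carrier} → IsRingHomomorphism F.rawRing S.rawRing f →
                     ∀ x → eval S.rawRing f x h S.≈ eval S.rawRing f x q S.* eval S.rawRing f x g
    exact-division S f-isHom x = S.trans (divMod-eval S f-isHom x g h)
      (S.trans (S.+-congˡ (Evaluation.eval-zero S f-isHom x r λ i → S.trans (f.⟦⟧-cong (r≈0 i)) f.0#-homo))
               (S.+-identityʳ _))
      where
      module S = CommutativeRing S
      module f = IsRingHomomorphism f-isHom

  record HasPrimitiveRoots (n : ℕ) : Set (c₂ ⊔ ℓ₂) where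
    field
      simple     : Simple ι (Φ F n)
      root⇒order : ∀ ξ → Φ F n ⟨ ξ ⟩ ≈ 0# → HasOrder K ξ n
      order⇒root : ∀ ξ → HasOrder K ξ n → Φ F n ⟨ ξ ⟩ ≈ 0#
  open HasPrimitiveRoots

  productΦ-root⁻ : ∀ ds ξ → productΦ ds ⟨ ξ ⟩ ≈ 0# → ∃ λ d → d ∈ ds × Φ F d ⟨ ξ ⟩ ≈ 0#
  productΦ-root⁻ []       ξ e = contradiction
    (trans (sym (trans (Evaluation.eval-const commutativeRing ι-isHom ξ F.1#) ι.1#-homo)) e) 1≉0
  productΦ-root⁻ (d ∷ ds) ξ e with zero-product (trans (sym (eval-product (Φ F d) (productΦ ds) ξ)) e)
  ... | inj₁ Φ≈0 = d , here ≡.refl , Φ≈0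
  ... | inj₂ P≈0 with productΦ-root⁻ ds ξ P≈0
  ...   | d′ , d′∈ds , Φ≈0 = d′ , there d′∈ds , Φ≈0

  productΦ-root⁺ : ∀ {ds d} ξ → d ∈ ds → Φ F d ⟨ ξ ⟩ ≈ 0# → productΦ ds ⟨ ξ ⟩ ≈ 0#
  productΦ-root⁺ {d ∷ ds} ξ (here ≡.refl) Φ≈0 = trans (eval-product (Φ F d) (productΦ ds) ξ) (x≈0⇒x*y≈0 Φ≈0)
  productΦ-root⁺ {d ∷ ds} ξ (there d∈ds)  Φ≈0 =
    trans (eval-product (Φ F d) (productΦ ds) ξ) (y≈0⇒x*y≈0 (productΦ-root⁺ ξ d∈ds Φ≈0))

  -- A common root of two factors would have two orders, so factors with different indices share no
  -- root. A repeated index would create double roots, hence the condition on `ds`.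
  productΦ-simple : ∀ ds → Unique ds → (∀ {d} → d ∈ ds → HasPrimitiveRoots d) → Simple ι (productΦ ds)
  productΦ-simple []       _          good ξ (re≈0 , _) = 1≉0 (begin
    1#                            ≈⟨ ι.1#-homo ⟨
    ι F.1#                        ≈⟨ +-identityʳ _ ⟨
    ι F.1# + 0#                   ≈⟨ +-congˡ (zeroʳ ξ) ⟨
    ι F.1# + ξ * 0#               ≈⟨ re≈0 ⟩
    0#                            ∎)
    where open SetoidReasoning setoid
  productΦ-simple (d ∷ ds) (d∉ds ∷ u) good = simple-product {Φ F d} {productΦ ds}
    (simple (good (here ≡.refl))) (productΦ-simple ds u (good ∘ there)) disjoint
    where
    disjoint : ∀ ξ → Φ F d ⟨ ξ ⟩ ≈ 0# → ¬ (productΦ ds ⟨ ξ ⟩ ≈ 0#)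
    disjoint ξ Φ≈0 P≈0 with productΦ-root⁻ ds ξ P≈0
    ... | e , e∈ds , Φₑ≈0 = All.lookup d∉ds e∈ds
      (order-unique (root⇒order (good (here ≡.refl)) ξ Φ≈0) (root⇒order (good (there e∈ds)) ξ Φₑ≈0))

  eval-X^−1 : (S : CommutativeRing c ℓ) (let module S = CommutativeRing S)
              {f : F.Carrier → S.Carrier} → IsRingHomomorphism F.rawRing S.rawRing f →
              ∀ x n → eval S.rawRing f x (X^ n −1) S.≈
              RawSemiringDefinitions._^_ (RawRing.rawSemiring S.rawRing) x n S.+ S.- S.1#
  eval-X^−1 S f-isHom x n = S.trans (eval-+ ((F.0# ∷ F.1# ∷ []) ^ₚ n) (map F.-_ (F.1# ∷ [])))
    (S.+-cong (eval-X^ n) (S.trans (eval-neg (F.1# ∷ []))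
      (S.-‿cong (S.trans (eval-const F.1#) (IsRingHomomorphism.1#-homo f-isHom)))))
    where
    module S = CommutativeRing S
    open Evaluation S f-isHom x
    open RawSemiringDefinitions (RawRing.rawSemiring (F.rawRing [X])) using () renaming (_^_ to _^ₚ_)

  module _ {n} (1≤n : 1 ≤ n) (n≉0 : ¬ (n · 1# ≈ 0#))
           (good : ∀ {d} → d ∈ properDivisors n → HasPrimitiveRoots d) where
    private
      P = productΦ (properDivisors n)

      P-simple : Simple ι P
      P-simple = productΦ-simple (properDivisors n) (properDivisors-unique n) good

      P-roots : ∀ ξ → P ⟨ ξ ⟩ ≈ 0# → (X^ n −1) ⟨ ξ ⟩ ≈ 0#
      P-roots ξ Pξ≈0 with productΦ-root⁻ (properDivisors n) ξ Pξ≈0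
      ... | d , d∈ , Φ≈0 = trans (eval-X^−1 commutativeRing ι-isHom ξ n) (x≈y⇒x∙y⁻¹≈ε
        (power-divides (proj₂ (proj₂ (∈-properDivisors⁻ 1≤n d∈))) (proj₁ (proj₂ (root⇒order (good d∈) ξ Φ≈0)))))

    factorization : (S : CommutativeRing c ℓ) (let module S = CommutativeRing S)
                    {f : F.Carrier → S.Carrier} → IsRingHomomorphism F.rawRing S.rawRing f →
                    ∀ x → RawSemiringDefinitions._^_ (RawRing.rawSemiring S.rawRing) x n S.+ S.- S.1# S.≈
                    eval S.rawRing f x (Φ F n) S.* eval S.rawRing f x P
    factorization S {f} f-isHom x = S.trans (S.sym (eval-X^−1 S f-isHom x n))
      (≡.subst (λ p → eval S.rawRing f x (X^ n −1) S.≈ eval S.rawRing f x p S.* eval S.rawRing f x P)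
        (≡.sym (Φ-unfold 1≤n)) (exact-division {P} {X^ n −1} P-simple P-roots S f-isHom x))
      where module S = CommutativeRing S

    private
      not-double : ∀ ξ → ¬ ((Φ F n ⟨ ξ +ε⟩) K[ε].* (P ⟨ ξ +ε⟩) K[ε].≈ K[ε].0#)
      not-double ξ e = roots-of-unity-simple n n≉0 ξ
        (RingProperties.x∙y⁻¹≈ε⇒x≈y K[ε].ring _ _ (K[ε].trans (factorization K[ε] ι-isHomε (ξ , 1#)) e))

    extend-primitive-roots : HasPrimitiveRoots n
    extend-primitive-roots .simple ξ Φ≈0 = not-double ξ (K[ε].trans (K[ε].*-congʳ Φ≈0) (K[ε].zeroˡ (P ⟨ ξ +ε⟩)))
    extend-primitive-roots .root⇒order ξ Φ≈0 = order≡n (finite-order 1≤n ξⁿ≈1)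
      where
      ξⁿ≈1 : ξ ^ n ≈ 1#
      ξⁿ≈1 = x∙y⁻¹≈ε⇒x≈y _ _ (trans (factorization commutativeRing ι-isHom ξ) (x≈0⇒x*y≈0 Φ≈0))
      order≡n : (∃ λ d → HasOrder K ξ d) → HasOrder K ξ n
      order≡n (d , ord@(1≤d , _)) with order-divides ord ξⁿ≈1
      ... | d∣n with ℕ.m≤n⇒m<n∨m≡n (∣⇒≤ {{ℕ.>-nonZero 1≤n}} d∣n)
      ...   | inj₂ ≡.refl = ord
      -- For d < n the element ξ is a root of Φ_d and so of P, besides being a root of Φₙ. Both
      -- values at ξ + ε are then multiples of ε, and their product is 0.
      ...   | inj₁ d<n = ⊥-elim (not-double ξ (x≈0⇒x*y≈0 Φ₁≈0 ,
                trans (+-cong (x≈0⇒x*y≈0 Φ₁≈0) (y≈0⇒x*y≈0 P₁≈0)) (+-identityˡ _)))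
        where
        d∈ = ∈-properDivisors⁺ 1≤d d<n d∣n
        Φ₁≈0 = real≈0 {Φ F n} Φ≈0
        P₁≈0 = real≈0 {P} (productΦ-root⁺ ξ d∈ (order⇒root (good d∈) ξ ord))
    extend-primitive-roots .order⇒root ξ ord@(_ , ξⁿ≈1 , _)
      with zero-product (trans (sym (factorization commutativeRing ι-isHom ξ)) (x≈y⇒x∙y⁻¹≈ε ξⁿ≈1))
    ... | inj₁ Φ≈0 = Φ≈0
    ... | inj₂ P≈0 with productΦ-root⁻ (properDivisors n) ξ P≈0
    ...   | d , d∈ , Φ≈0 = contradiction (order-unique (root⇒order (good d∈) ξ Φ≈0) ord)
                             (ℕ.<⇒≢ (proj₁ (proj₂ (∈-properDivisors⁻ 1≤n d∈))))

  primitive-roots : ∀ n → 1 ≤ n → ¬ (n · 1# ≈ 0#) → HasPrimitiveRoots n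
  primitive-roots = <-rec _ λ n rec 1≤n n≉0 → extend-primitive-roots 1≤n n≉0 λ d∈ →
    let (1≤d , d<n , divides k n≡k*d) = ∈-properDivisors⁻ 1≤n d∈ in
    -- The hypothesis passes to divisors: d = 0 in K would give n = k d = 0 in K.
    rec d<n 1≤d λ d≈0 → n≉0 (trans (reflexive (≡.cong (_· 1#) n≡k*d))
      (trans (×1-homo-* k _) (y≈0⇒x*y≈0 d≈0)))

-- Integers that vanish in a ring

module Characteristic (R : CommutativeRing c ℓ) where
  open CommutativeRing R hiding (zero)
  open ZeroProperties R using (y≈0⇒x*y≈0; y≈0⇒x+y≈x)
  open SumProperties +-commutativeMonoid using (sum; sum-permute; sum-cong-≋; sum-replicate; ∑-distrib-+)
  open RingProperties ring using (+-cancelˡ)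
  open RawSemiringDefinitions (RawRing.rawSemiring rawRing) using () renaming (_×_ to _·_)
  open MultProperties semiring using (×1-homo-*)

  -- Translation by 1 permutes R, so Σ x = Σ (x + 1) = Σ x + q.
  cardinality-annihilates : ∀ {q} → Inverse setoid (≡.setoid (Fin q)) → q · 1# ≈ 0#
  cardinality-annihilates {q} R↔Fin = sym (+-cancelˡ (sum from) 0# (q · 1#) (begin
    sum from + 0#                    ≈⟨ +-identityʳ _ ⟩
    sum from
      ≈⟨ sum-permute from (permutation (translate 1#) (translate (- 1#))
                                          (translate-inverse (-‿inverseˡ 1#)) (translate-inverse (-‿inverseʳ 1#))) ⟩
    sum (from ∘ translate 1#)        ≈⟨ sum-cong-≋ (λ i → strictlyInverseʳ (from i + 1#)) ⟩
    sum (λ i → from i + 1#)          ≈⟨ ∑-distrib-+ from (λ _ → 1#) ⟩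
    sum from + sum {q} (λ _ → 1#)    ≈⟨ +-congˡ (sum-replicate q) ⟩
    sum from + q · 1#                ∎))
    where
    open SetoidReasoning setoid
    open Inverse R↔Fin

    translate : Carrier → Fin q → Fin q
    translate a i = to (from i + a)

    translate-inverse : ∀ {a b} → b + a ≈ 0# → ∀ i → translate a (translate b i) ≡ i
    translate-inverse {a} {b} b+a≈0 i = ≡.trans (to-cong (begin
      from (to (from i + b)) + a    ≈⟨ +-congʳ (strictlyInverseʳ (from i + b)) ⟩
      (from i + b) + a              ≈⟨ +-assoc _ _ _ ⟩
      from i + (b + a)              ≈⟨ +-congˡ b+a≈0 ⟩
      from i + 0#                   ≈⟨ +-identityʳ _ ⟩
      from i                        ∎)) (strictlyInverseˡ i)

  consecutive : ∀ {m n} → suc m ≡ n → m · 1# ≈ 0# → n · 1# ≈ 0# → 1# ≈ 0#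
  consecutive ≡.refl m≈0 n≈0 = trans (sym (y≈0⇒x+y≈x m≈0)) n≈0

  multiple-annihilates : ∀ k {m} → m · 1# ≈ 0# → (k ℕ.* m) · 1# ≈ 0#
  multiple-annihilates k {m} m≈0 = trans (×1-homo-* k m) (y≈0⇒x*y≈0 m≈0)

  -- In the natural numbers Bézout reads 1 + y n = x m, or 1 + x m = y n; either way two consecutive
  -- numbers vanish in the ring.
  coprime-annihilators : ∀ {m n} → Coprime m n → m · 1# ≈ 0# → n · 1# ≈ 0# → 1# ≈ 0#
  coprime-annihilators coprime m≈0 n≈0 with coprime-Bézout coprime
  ... | Bézout.+- x y eq = consecutive eq (multiple-annihilates y n≈0) (multiple-annihilates x m≈0)
  ... | Bézout.-+ x y eq = consecutive eq (multiple-annihilates x m≈0) (multiple-annihilates y n≈0)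

-- The quadratic extension of F[B,C] by a generic root, and its norm

module QuadraticExtension (F : Field c ℓ) where
  private
    module F = Field F
    module P = RawRing (F[B,C] F)

  -- −B and C as elements of F[B,C].
  T₁ C₁ : P.Carrier
  T₁ = map F.-_ (F.0# ∷ F.1# ∷ []) ∷ []
  C₁ = [] ∷ (F.1# ∷ []) ∷ []

  -- (s₀ , s₁) stands for s₀ + s₁ Y in F[B,C][Y] / (Y² + B Y + C), where X = −B − Y.
  Element : Set c
  Element = P.Carrier × P.Carrier

  add : Element → Element → Element
  add (s₀ , s₁) (t₀ , t₁) = s₀ P.+ t₀ , s₁ P.+ t₁

  -- The products are reduced by X Y = C and Y² = -B Y - C.
  mulX mulY neg : Element → Element
  mulX (s₀ , s₁) = T₁ P.* s₀ P.+ C₁ P.* s₁ , P.- s₀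
  mulY (s₀ , s₁) = P.- (C₁ P.* s₁) , s₀ P.+ T₁ P.* s₁
  neg  (s₀ , s₁) = P.- s₀ , P.- s₁

  mulY^ : ℕ → Element → Element
  mulY^ zero    s = s
  mulY^ (suc n) s = mulY (mulY^ n s)

  -- The product of s₀ + s₁ Y with its conjugate s₀ + s₁ X, expanded by X + Y = -B and X Y = C.
  norm : Element → P.Carrier
  norm (s₀ , s₁) = s₀ P.* s₀ P.+ T₁ P.* (s₀ P.* s₁) P.+ C₁ P.* (s₁ P.* s₁)

  -- Y ^ length p · p(X / Y)
  homogenize : List F.Carrier → Element
  homogenize []      = P.0# , P.0#
  homogenize (a ∷ p) = add (mulY^ (suc (length p)) ((a ∷ []) ∷ [] , P.0#)) (mulX (homogenize p))

  -- Y ^ length p · (Λ − Y ^ k · p(X / Y))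
  relation : P.Carrier → List F.Carrier → ℕ → Element
  relation Λ p k = add (mulY^ (length p) (Λ , P.0#)) (neg (mulY^ k (homogenize p)))

  -- One computation for two readings: at the generic point (B, C) in the closure of F(B,C), and at
  -- the images of b and c in the closure of F.
  module Value (S : CommutativeRing c₁ ℓ₁) {f : F.Carrier → CommutativeRing.Carrier S}
               (f-isHom : IsRingHomomorphism F.rawRing (CommutativeRing.rawRing S) f)
               {b c : CommutativeRing.Carrier S} where
    open CommutativeRing S hiding (zero)
    open ZeroProperties S using (x≈0⇒x*y≈0; y≈0⇒x+y≈x)
    open SetoidReasoning setoid
    open SemiringSolver commutativeSemiring using (solve; _:=_; _:+_; _:*_)
    open RingProperties ring using (-‿involutive; -‿distribˡ-*)
    open RawSemiringDefinitions (RawRing.rawSemiring rawRing) using (_^_)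

    private module Inner = Evaluation S f-isHom b

    value : P.Carrier → Carrier
    value = eval rawRing (eval rawRing f b) c

    value-isHom : IsRingHomomorphism (F[B,C] F) rawRing value
    value-isHom = Evaluation.eval-isRingHomomorphism S Inner.eval-isRingHomomorphism c

    private
      module Outer = Evaluation S Inner.eval-isRingHomomorphism c
      module value = IsRingHomomorphism value-isHom

    value-C : value C₁ ≈ c
    value-C = Outer.eval-X

    value-const : ∀ a → value ((a ∷ []) ∷ []) ≈ f a
    value-const a = trans (Outer.eval-const (a ∷ [])) (Inner.eval-const a)

    module _ {x y : Carrier} (b≈ : b ≈ - (x + y)) (c≈ : c ≈ x * y) where

      value-T : value T₁ ≈ x + y
      value-T = begin
        value T₁         ≈⟨ Outer.eval-const (map F.-_ (F.0# ∷ F.1# ∷ [])) ⟩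
        eval rawRing f b (map F.-_ (F.0# ∷ F.1# ∷ []))  ≈⟨ Inner.eval-neg (F.0# ∷ F.1# ∷ []) ⟩
        - eval rawRing f b (F.0# ∷ F.1# ∷ [])           ≈⟨ -‿cong Inner.eval-X ⟩
        - b              ≈⟨ -‿cong b≈ ⟩
        - - (x + y)      ≈⟨ -‿involutive _ ⟩
        x + y            ∎

      value-C* : ∀ s → value (C₁ P.* s) ≈ x * y * value s
      value-C* s = trans (value.*-homo C₁ s) (*-congʳ (trans value-C c≈))

      value-T* : ∀ s → value (T₁ P.* s) ≈ (x + y) * value s
      value-T* s = trans (value.*-homo T₁ s) (*-congʳ value-T)

      -- The substitution Y ↦ y, under which X = -B - Y becomes x. As x and y are module parameters,
      -- exchanging them yields the conjugate value.
      ⟦_⟧ : Element → Carrier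
      ⟦ s₀ , s₁ ⟧ = value s₀ + value s₁ * y

      ⟦⟧-add : ∀ s t → ⟦ add s t ⟧ ≈ ⟦ s ⟧ + ⟦ t ⟧
      ⟦⟧-add (s₀ , s₁) (t₀ , t₁) = begin
        value (s₀ P.+ t₀) + value (s₁ P.+ t₁) * y
          ≈⟨ +-cong (value.+-homo s₀ t₀) (*-congʳ (value.+-homo s₁ t₁)) ⟩
        (value s₀ + value t₀) + (value s₁ + value t₁) * y
          ≈⟨ solve 5 (λ a b c d y → (a :+ b) :+ (c :+ d) :* y := (a :+ c :* y) :+ (b :+ d :* y)) refl
               (value s₀) (value t₀) (value s₁) (value t₁) y ⟩
        (value s₀ + value s₁ * y) + (value t₀ + value t₁ * y) ∎

      ⟦⟧-neg : ∀ s → ⟦ neg s ⟧ ≈ - ⟦ s ⟧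
      ⟦⟧-neg (s₀ , s₁) = begin
        value (P.- s₀) + value (P.- s₁) * y
          ≈⟨ +-cong (value.-‿homo s₀) (*-congʳ (value.-‿homo s₁)) ⟩
        - value s₀ + - value s₁ * y            ≈⟨ +-congˡ (-‿distribˡ-* _ y) ⟨
        - value s₀ + - (value s₁ * y)          ≈⟨ RingProperties.-‿+-comm ring _ _ ⟩
        - (value s₀ + value s₁ * y)            ∎

      ⟦⟧-constant : ∀ s → ⟦ s , P.0# ⟧ ≈ value s
      ⟦⟧-constant s = y≈0⇒x+y≈x (zeroˡ y)

      ⟦⟧-mulX : ∀ s → ⟦ mulX s ⟧ ≈ x * ⟦ s ⟧
      ⟦⟧-mulX (s₀ , s₁) = begin
        value (T₁ P.* s₀ P.+ C₁ P.* s₁) + value (P.- s₀) * y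
          ≈⟨ +-cong (trans (value.+-homo (T₁ P.* s₀) (C₁ P.* s₁)) (+-cong (value-T* s₀) (value-C* s₁)))
                    (*-congʳ (value.-‿homo s₀)) ⟩
        ((x + y) * v₀ + x * y * v₁) + - v₀ * y
          ≈⟨ solve 5 (λ x y v₀ v₁ n → ((x :+ y) :* v₀ :+ x :* y :* v₁) :+ n :* y
               := x :* (v₀ :+ v₁ :* y) :+ (v₀ :+ n) :* y) refl
               x y v₀ v₁ (- v₀) ⟩
        x * (v₀ + v₁ * y) + (v₀ + - v₀) * y
          ≈⟨ +-congˡ (x≈0⇒x*y≈0 (-‿inverseʳ v₀)) ⟩
        x * (v₀ + v₁ * y) + 0#
          ≈⟨ +-identityʳ _ ⟩
        x * (v₀ + v₁ * y) ∎
        where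
        v₀ = value s₀
        v₁ = value s₁

      ⟦⟧-mulY : ∀ s → ⟦ mulY s ⟧ ≈ y * ⟦ s ⟧
      ⟦⟧-mulY (s₀ , s₁) = begin
        value (P.- (C₁ P.* s₁)) + value (s₀ P.+ T₁ P.* s₁) * y
          ≈⟨ +-cong (trans (value.-‿homo (C₁ P.* s₁)) (-‿cong (value-C* s₁)))
                    (*-congʳ (trans (value.+-homo s₀ (T₁ P.* s₁)) (+-congˡ (value-T* s₁)))) ⟩
        - (x * y * v₁) + (v₀ + (x + y) * v₁) * y
          ≈⟨ solve 5 (λ x y v₀ v₁ n → n :+ (v₀ :+ (x :+ y) :* v₁) :* y
               := y :* (v₀ :+ v₁ :* y) :+ (x :* y :* v₁ :+ n)) refl
               x y v₀ v₁ (- (x * y * v₁)) ⟩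
        y * (v₀ + v₁ * y) + (x * y * v₁ + - (x * y * v₁))
          ≈⟨ +-congˡ (-‿inverseʳ _) ⟩
        y * (v₀ + v₁ * y) + 0#
          ≈⟨ +-identityʳ _ ⟩
        y * (v₀ + v₁ * y) ∎
        where
        v₀ = value s₀
        v₁ = value s₁

      ⟦⟧-mulY^ : ∀ n s → ⟦ mulY^ n s ⟧ ≈ y ^ n * ⟦ s ⟧
      ⟦⟧-mulY^ zero    s = sym (*-identityˡ _)
      ⟦⟧-mulY^ (suc n) s = trans (⟦⟧-mulY (mulY^ n s)) (trans (*-congˡ (⟦⟧-mulY^ n s)) (sym (*-assoc y _ _)))

      module _ {w} (yw≈1 : y * w ≈ 1#) where

        ⟦⟧-homogenize : ∀ p → ⟦ homogenize p ⟧ ≈ y ^ length p * eval rawRing f (x * w) p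
        ⟦⟧-homogenize []      = trans (⟦⟧-constant P.0#) (sym (zeroʳ _))
        ⟦⟧-homogenize (a ∷ p) = begin
          ⟦ add (mulY^ (suc l) constant) (mulX (homogenize p)) ⟧
            ≈⟨ ⟦⟧-add (mulY^ (suc l) constant) (mulX (homogenize p)) ⟩
          ⟦ mulY^ (suc l) constant ⟧ + ⟦ mulX (homogenize p) ⟧
            ≈⟨ +-cong (trans (⟦⟧-mulY^ (suc l) constant) (*-congˡ (trans (⟦⟧-constant ((a ∷ []) ∷ [])) (value-const a))))
                      (trans (⟦⟧-mulX (homogenize p)) (*-congˡ (⟦⟧-homogenize p))) ⟩
          y * y ^ l * f a + x * (y ^ l * e)
            -- Inserting 1 = y w rewrites x as y (x w); this supplies the power of y by which the
            -- tail, being one shorter, falls behind.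
            ≈⟨ +-congˡ (*-identityˡ _) ⟨
          y * y ^ l * f a + 1# * (x * (y ^ l * e))
            ≈⟨ +-congˡ (*-congʳ yw≈1) ⟨
          y * y ^ l * f a + y * w * (x * (y ^ l * e))
            ≈⟨ solve 6 (λ x y w z a e → y :* z :* a :+ y :* w :* (x :* (z :* e))
               := y :* z :* (a :+ x :* w :* e)) refl
                 x y w (y ^ l) (f a) e ⟩
          y * y ^ l * (f a + x * w * e) ∎
          where
          l = length p
          e = eval rawRing f (x * w) p
          constant = (a ∷ []) ∷ [] , P.0#

        ⟦⟧-relation : ∀ Λ p k → ⟦ relation Λ p k ⟧ ≈
                      y ^ length p * value Λ + - (y ^ length p * (y ^ k * eval rawRing f (x * w) p))
        ⟦⟧-relation Λ p k = trans (⟦⟧-add (mulY^ l (Λ , P.0#)) (neg (mulY^ k (homogenize p))))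
          (+-cong (trans (⟦⟧-mulY^ l (Λ , P.0#)) (*-congˡ (⟦⟧-constant Λ)))
            (trans (⟦⟧-neg (mulY^ k (homogenize p))) (-‿cong (begin
              ⟦ mulY^ k (homogenize p) ⟧   ≈⟨ ⟦⟧-mulY^ k (homogenize p) ⟩
              y ^ k * ⟦ homogenize p ⟧     ≈⟨ *-congˡ (⟦⟧-homogenize p) ⟩
              y ^ k * (y ^ l * e)
                ≈⟨ solve 3 (λ k l e → k :* (l :* e) := l :* (k :* e)) refl (y ^ k) (y ^ l) e ⟩
              y ^ l * (y ^ k * e)          ∎))))
          where
          l = length p
          e = eval rawRing f (x * w) p

    module _ {x y : Carrier} (b≈ : b ≈ - (x + y)) (c≈ : c ≈ x * y)
             (b≈′ : b ≈ - (y + x)) (c≈′ : c ≈ y * x) where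

      value-norm : ∀ s → value (norm s) ≈ ⟦_⟧ b≈ c≈ s * ⟦_⟧ b≈′ c≈′ s
      value-norm (s₀ , s₁) = begin
        value (s₀ P.* s₀ P.+ T₁ P.* (s₀ P.* s₁) P.+ C₁ P.* (s₁ P.* s₁))
          ≈⟨ value.+-homo (s₀ P.* s₀ P.+ T₁ P.* (s₀ P.* s₁)) (C₁ P.* (s₁ P.* s₁)) ⟩
        value (s₀ P.* s₀ P.+ T₁ P.* (s₀ P.* s₁)) + value (C₁ P.* (s₁ P.* s₁))
          ≈⟨ +-cong (trans (value.+-homo (s₀ P.* s₀) (T₁ P.* (s₀ P.* s₁)))
                      (+-cong (value.*-homo s₀ s₀) (trans (value-T* b≈ c≈ (s₀ P.* s₁)) (*-congˡ (value.*-homo s₀ s₁)))))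
                    (trans (value-C* b≈ c≈ (s₁ P.* s₁)) (*-congˡ (value.*-homo s₁ s₁))) ⟩
        v₀ * v₀ + (x + y) * (v₀ * v₁) + x * y * (v₁ * v₁)
          ≈⟨ solve 4 (λ x y v₀ v₁ → v₀ :* v₀ :+ (x :+ y) :* (v₀ :* v₁) :+ x :* y :* (v₁ :* v₁)
               := (v₀ :+ v₁ :* y) :* (v₀ :+ v₁ :* x)) refl
               x y v₀ v₁ ⟩
        (v₀ + v₁ * y) * (v₀ + v₁ * x) ∎
        where
        v₀ = value s₀
        v₁ = value s₁

-- The identity satisfied by the Lucas atom at the generic roots

module GenericIdentity {F : Field c ℓ} (G : GenericRoots F c₁ ℓ₁ c₂ ℓ₂) where
  open GenericRoots G
  open QuadraticExtension F
  private
    module F = Field F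
    module FF = Field F⟨B,C⟩
    module R = RationalFunctionField functionField
    module A = AlgebraicClosure algebraicClosure
    module ι = IsRingHomomorphism A.ι-isHom
  open Field Ω hiding (zero)
  open ZeroProperties commutativeRing using (x≈0⇒x*y≈0)
  open FieldProperties Ω using (vieta; nonzero-factors)
  open RingProperties ring using (x≈y⇒x∙y⁻¹≈ε)

  F→Ω-isHom : IsHom F Ω F→Ω
  F→Ω-isHom = isRingHomomorphism trans R.ι-isHom A.ι-isHom

  -- Algebraic independence survives in the closure, since the embedding of F(B,C) is injective and
  -- commutes with evaluation.
  specialization-injective : ∀ P → eval₂ Ω F→Ω (F⟨B,C⟩→Ω B) (F⟨B,C⟩→Ω C) P ≈ 0# →
                             RawRing._≈_ (F[B,C] F) P []
  specialization-injective P e = R.independent P (FieldProperties.hom-reflects-0 F⟨B,C⟩ Ω A.ι-isHom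
    (trans (hom-eval FF.commutativeRing commutativeRing A.ι-isHom (eval FF.rawRing F→F⟨B,C⟩ B)
             (hom-eval FF.commutativeRing commutativeRing A.ι-isHom F→F⟨B,C⟩ (λ _ → refl) refl) refl P) e))

  open Value commutativeRing F→Ω-isHom {F⟨B,C⟩→Ω B} {F⟨B,C⟩→Ω C}

  C≉0 : ¬ (F⟨B,C⟩→Ω C ≈ 0#)
  -- The indices 1 and 0 select the coefficient of C¹B⁰ in the polynomial C, which is 1.
  C≉0 C≈0 = F.1≉0 (EqPoly.coeff-≈ (EqPoly.coeff-≈ (specialization-injective C₁ (trans value-C C≈0)) 1) 0)

  private
    B≈ = proj₁ (vieta roots)
    C≈ = proj₂ (vieta roots)

  β≉0 : ¬ (β ≈ 0#)
  β≉0 = proj₂ (nonzero-factors C≉0 C≈)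

  -- Of the two conjugate factors of the norm, the one with Y = β is zero by the defining equation
  -- of the Lucas atom.
  norm-relation-zero : ∀ {n Λ} → 2 ≤ n → IsLucasAtom n Λ →
                       RawRing._≈_ (F[B,C] F) (norm (relation Λ (Φ F n) (totient n))) []
  norm-relation-zero {n} {Λ} 2≤n (_ , atom) = specialization-injective (norm s) (trans
    (value-norm B≈ C≈ (trans B≈ (-‿cong (+-comm α β))) (trans C≈ (*-comm α β)) s)
    (x≈0⇒x*y≈0 (trans (⟦⟧-relation B≈ C≈ (inverseʳ β β≉0) Λ (Φ F n) (totient n))
                      (x≈y⇒x∙y⁻¹≈ε (*-congˡ (atom 2≤n))))))
    where s = relation Λ (Φ F n) (totient n)

-- Specialization at the roots of a given quadratic

module Specialization (F : Field c₁ ℓ₁) (K : Field c₂ ℓ₂)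
                      {ι : Field.Carrier F → Field.Carrier K} (ι-isHom : IsHom F K ι)
                      {b c : Field.Carrier K} where
  open Field K hiding (zero)
  open ZeroProperties commutativeRing using (y≈0⇒x*y≈0)
  open QuadraticExtension F
  open Value commutativeRing ι-isHom {b} {c}
  open FieldProperties K using (cancel-power)
  open RingProperties ring using (x∙y⁻¹≈ε⇒x≈y)

  -- Both the powers of y that clear denominators and the factor yᵏ are nonzero, so cancelling them
  -- does not affect vanishing.
  relation-zero : ∀ {x y} (b≈ : b ≈ - (x + y)) (c≈ : c ≈ x * y) → ¬ (y ≈ 0#) →
                  ∀ Λ p k → ⟦_⟧ b≈ c≈ (relation Λ p k) ≈ 0# →
                  value Λ ≈ 0# ⇔ eval rawRing ι (x * y ⁻¹) p ≈ 0#
  relation-zero {x} {y} b≈ c≈ y≉0 Λ p k e = mk⇔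
    (λ Λ≈0 → cancel-power y≉0 k (cancel-power y≉0 (length p) (trans (sym equal) (y≈0⇒x*y≈0 Λ≈0))))
    (λ p≈0 → cancel-power y≉0 (length p) (trans equal (y≈0⇒x*y≈0 (y≈0⇒x*y≈0 p≈0))))
    where
    equal : y ^ length p * value Λ ≈ y ^ length p * (y ^ k * eval rawRing ι (x * y ⁻¹) p)
    equal = x∙y⁻¹≈ε⇒x≈y _ _ (trans (sym (⟦⟧-relation b≈ c≈ (inverseʳ y y≉0) Λ p k)) e)

lemma5p1 : ∀ {c ℓ c₁ ℓ₁ c₂ ℓ₂ c₃ ℓ₃ : Level}
    (q : ℕ) → IsOddPrimePower q →
    (F : Field c ℓ) → ∣ F ∣≡ q →
    (G : GenericRoots F c₁ ℓ₁ c₂ ℓ₂) →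
    (F̄ : AlgebraicClosure F c₃ ℓ₃) →
    let module F = Field F
        module G = GenericRoots G
        open AlgebraicClosure F̄ using (ι) renaming (closure to K)
        module K = Field K
    in
    (b c : F.Carrier) → ¬ (c F.≈ F.0#) →
    (θ₁ θ₂ : K.Carrier) → RootsOf K (ι b) (ι c) θ₁ θ₂ →
    (n : ℕ) → 1 ≤ n → Coprime n q →
    ¬ (n ≡ 1 × θ₁ K.≈ θ₂) →
    (Λ : List (List F.Carrier)) → G.IsLucasAtom n Λ →
    (eval₂ F id b c Λ F.≈ F.0#) ⇔ HasOrder K (θ₁ K.* θ₂ K.⁻¹) n
lemma5p1 q _ F F↔Fin G F̄ b c c≉0 θ₁ θ₂ roots n 1≤n coprime distinct Λ atom with ℕ.m≤n⇒m<n∨m≡n 1≤n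
-- By convention Λ₁ = 1 rather than the value α - β of Φ₁ʰᵒᵐ, so Λ₁(b,c) never vanishes. The
-- quotient has order 1 exactly when θ₁ = θ₂, which is excluded for n = 1, so both sides are false.
... | inj₂ ≡.refl = mk⇔
  (λ Λ≈0 → contradiction (F.trans (F.sym Λ≈1) Λ≈0) F.1≉0)
  (λ (_ , ratio≈1 , _) → contradiction (≡.refl , θ₁≈θ₂ ratio≈1) distinct)
  where
  module F = Field F
  open AlgebraicClosure F̄ renaming (closure to K)
  open Field K hiding (zero)
  open FieldProperties K using (vieta; nonzero-factors)
  module value = IsRingHomomorphism (QuadraticExtension.Value.value-isHom F F.commutativeRing
    (Identity.isRingHomomorphism F.rawRing F.refl) {b} {c})

  Λ≈1 : eval₂ F id b c Λ F.≈ F.1#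
  Λ≈1 = F.trans (value.⟦⟧-cong (proj₁ atom ≡.refl)) value.1#-homo

  θ₂≉0 : ¬ (θ₂ ≈ 0#)
  θ₂≉0 = proj₂ (nonzero-factors (c≉0 ∘ FieldProperties.hom-reflects-0 F K ι-isHom) (proj₂ (vieta roots)))

  θ₁≈θ₂ : (θ₁ * θ₂ ⁻¹) * 1# ≈ 1# → θ₁ ≈ θ₂
  θ₁≈θ₂ ratio≈1 = begin
    θ₁                                ≈⟨ *-identityʳ θ₁ ⟨
    θ₁ * 1#                           ≈⟨ *-congˡ (trans (*-comm _ _) (inverseʳ θ₂ θ₂≉0)) ⟨
    θ₁ * (θ₂ ⁻¹ * θ₂)                 ≈⟨ *-assoc θ₁ (θ₂ ⁻¹) θ₂ ⟨
    (θ₁ * θ₂ ⁻¹) * θ₂                 ≈⟨ *-congʳ (trans (sym (*-identityʳ _)) ratio≈1) ⟩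
    1# * θ₂                           ≈⟨ *-identityˡ θ₂ ⟩
    θ₂                                ∎
    where open SetoidReasoning setoid
-- The norm is zero as a polynomial, so its value at (b, c) is zero too; in the field K one of the
-- two conjugate factors must vanish.
... | inj₁ 2≤n = split (zero-product (trans (sym (value-norm b≈ c≈ b≈′ c≈′ s))
                                            (value.⟦⟧-cong (norm-relation-zero 2≤n atom))))
  where
  module F = Field F
  open AlgebraicClosure F̄ renaming (closure to K)
  open Field K hiding (zero)
  open FieldProperties K using (zero-product; vieta; nonzero-factors; quotient-inverse)
  open QuadraticExtension F
  open GenericIdentity G using (norm-relation-zero)
  open Specialization F K ι-isHom using (relation-zero)
  open Value commutativeRing ι-isHom {ι b} {ι c}
  open Characteristic commutativeRing using (coprime-annihilators)
  open CyclotomicRoots F K isClosed ι-isHom using (HasPrimitiveRoots; primitive-roots)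
  open RawSemiringDefinitions (RawRing.rawSemiring rawRing) using () renaming (_×_ to _·_)
  open RawSemiringDefinitions (RawRing.rawSemiring F.rawRing) using () renaming (_×_ to _·F_)
  module ι = IsRingHomomorphism ι-isHom
  module value = IsRingHomomorphism value-isHom

  s = relation Λ (Φ F n) (totient n)
  b≈ = proj₁ (vieta roots)
  c≈ = proj₂ (vieta roots)
  b≈′ = trans b≈ (-‿cong (+-comm θ₁ θ₂))
  c≈′ = trans c≈ (*-comm θ₁ θ₂)

  ι-reflects-0 : ∀ {a} → ι a ≈ 0# → a F.≈ F.0#
  ι-reflects-0 = FieldProperties.hom-reflects-0 F K ι-isHom

  θ₁≉0 = proj₁ (nonzero-factors (c≉0 ∘ ι-reflects-0) c≈)
  θ₂≉0 = proj₂ (nonzero-factors (c≉0 ∘ ι-reflects-0) c≈)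

  ι-multiple : ∀ m → ι (m ·F F.1#) ≈ m · 1#
  ι-multiple zero    = ι.0#-homo
  ι-multiple (suc m) = trans (ι.+-homo _ _) (+-cong ι.1#-homo (ι-multiple m))

  q≈0 : q · 1# ≈ 0#
  q≈0 = trans (sym (ι-multiple q))
    (trans (ι.⟦⟧-cong (Characteristic.cardinality-annihilates F.commutativeRing F↔Fin)) ι.0#-homo)

  open HasPrimitiveRoots (primitive-roots n 1≤n (λ n≈0 → 1≉0 (coprime-annihilators coprime n≈0 q≈0)))

  ι-value : ι (eval₂ F id b c Λ) ≈ value Λ
  ι-value = hom-eval F.commutativeRing commutativeRing ι-isHom (eval F.rawRing id b)
    (hom-eval F.commutativeRing commutativeRing ι-isHom id (λ _ → refl) refl) refl Λ

  through-root : ∀ ξ → (value Λ ≈ 0# ⇔ eval rawRing ι ξ (Φ F n) ≈ 0#) →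
                 (eval₂ F id b c Λ F.≈ F.0#) ⇔ HasOrder K ξ n
  through-root ξ Λ⇔Φ = mk⇔
    (λ Λ≈0 → root⇒order ξ (Equivalence.to Λ⇔Φ (trans (sym ι-value) (trans (ι.⟦⟧-cong Λ≈0) ι.0#-homo))))
    (λ ord → ι-reflects-0 (trans ι-value (Equivalence.from Λ⇔Φ (order⇒root ξ ord))))

  split : ⟦_⟧ b≈ c≈ s ≈ 0# ⊎ ⟦_⟧ b≈′ c≈′ s ≈ 0# →
          (eval₂ F id b c Λ F.≈ F.0#) ⇔ HasOrder K (θ₁ * θ₂ ⁻¹) n
  split (inj₁ s≈0) = through-root _ (relation-zero b≈ c≈ θ₂≉0 Λ (Φ F n) (totient n) s≈0)
  split (inj₂ s≈0) = mk⇔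
    (λ Λ≈0 → order-inverse (quotient-inverse θ₂≉0 θ₁≉0) (Equivalence.to swapped Λ≈0))
    (λ ord → Equivalence.from swapped (order-inverse (quotient-inverse θ₁≉0 θ₂≉0) ord))
    where
    open Order K using (order-inverse)
    swapped = through-root _ (relation-zero b≈′ c≈′ θ₁≉0 Λ (Φ F n) (totient n) s≈0)
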